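{- For all positive integers $s,t$ with $3\le s\le t-1$, $\mathrm{ex}\big(n,(K_{s+1,t}^+)^{\mathrm{sub}}\big)=O\!\left(n^{1+\frac{s^2+1}{2s+2s^2}}\right)$; that is, there is a constant $C=C(s,t)$ such that every $n$-vertex graph not containing $(K_{s+1,t}^+)^{\mathrm{sub}}$ as a subgraph has at most $C\,n^{1+\frac{s^2+1}{2s+2s^2}}$ edges.
   Context: $\mathrm{ex}(n,F)$ denotes the maximum number of edges of an $n$-vertex graph containing no (not necessarily induced) subgraph isomorphic to $F$. $K_{s+1,t}^+$ is the graph obtained from a copy of the complete bipartite graph $K_{s,t}$ (with parts of sizes $s$ and $t$) by adding one new vertex $r$ joined to exactly one vertex of the $s$-part and to all vertices of the $t$-part. For a graph $H$, $H^{\mathrm{sub}}$ denotes its $1$-subdivision, obtained by replacing each edge by a path of length two. -}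

module Defs where

open import Data.Nat using (ℕ; zero; suc; _+_; _*_; _^_; _≤_; _<_)
open import Data.Fin using (Fin; toℕ)
import Data.Fin as Fin
open import Data.Bool using (Bool; T; true; false)
open import Data.Bool.Properties using (T?)
open import Data.Product using (Σ; _×_; _,_; proj₁; proj₂)
open import Data.Sum using (_⊎_; inj₁; inj₂)
open import Data.Unit using (⊤)
open import Data.List using (List; length; filter; cartesianProduct; allFin)
open import Relation.Binary.PropositionalEquality using (_≡_)
open import Relation.Nullary using (¬_)
open import Relation.Nullary.Decidable using (_×-dec_)
open import Function.Definitions using (Injective)

record SimpleGraph (n : ℕ) : Set where
  field
    adj    : Fin n → Fin n → Bool
    sym    : ∀ i j → adj i j ≡ adj j i
    irrefl : ∀ i → adj i i ≡ false
open SimpleGraph public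

edgeCount : {n : ℕ} → SimpleGraph n → ℕ
edgeCount {n} G =
  length (filter (λ p → (proj₁ p Fin.<? proj₂ p) ×-dec T? (adj G (proj₁ p) (proj₂ p)))
                 (cartesianProduct (allFin n) (allFin n)))

record EdgeGraph : Set₁ where
  field
    Vtx  : Set
    Edg  : Set
    end₁ : Edg → Vtx
    end₂ : Edg → Vtx
open EdgeGraph public

Contains : {n : ℕ} → SimpleGraph n → EdgeGraph → Set
Contains {n} G F =
  Σ (Vtx F → Fin n) λ φ →
    Injective _≡_ _≡_ φ ×
    (∀ (e : Edg F) → T (adj G (φ (end₁ F e)) (φ (end₂ F e))))

data SubEdge (E : Set) : Set where
  first  : E → SubEdge E
  second : E → SubEdge E

subdivision : EdgeGraph → EdgeGraph
subdivision F = record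
  { Vtx  = Vtx F ⊎ Edg F
  ; Edg  = SubEdge (Edg F)
  ; end₁ = λ { (first e) → inj₁ (end₁ F e) ; (second e) → inj₂ e }
  ; end₂ = λ { (first e) → inj₂ e ; (second e) → inj₁ (end₂ F e) }
  }

-- K_{s+1,t}^+ : vertices of the s-part (Fin s), the t-part (Fin t), and r.
data KVtx (s t : ℕ) : Set where
  aV : Fin s → KVtx s t
  bV : Fin t → KVtx s t
  rV : KVtx s t

data KEdg (s t : ℕ) : Set where
  ab : Fin s → Fin t → KEdg s t
  ra : (a : Fin s) → toℕ a ≡ 0 → KEdg s t      -- r – a₀ (the single s-part vertex with index 0)
  rb : Fin t → KEdg s t

Kplus : ℕ → ℕ → EdgeGraph
Kplus s t = record
  { Vtx  = KVtx s t
  ; Edg  = KEdg s t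
  ; end₁ = λ { (ab a b) → aV a ; (ra a _) → rV ; (rb b) → rV }
  ; end₂ = λ { (ab a b) → bV b ; (ra a _) → aV a ; (rb b) → bV b }
  }

{-# OPTIONS --safe #-}

-- Pass to a bipartite subgraph (A, B) of large minimum degree. Call two vertices of one side heavy if
-- they have many common neighbours; a large clique of heavy pairs contains the subdivision greedily, so
-- heavy cliques are bounded and a positive proportion of the paths w y z x of length three have both
-- {w, z} and {y, x} not heavy. Fix w ∈ B starting many such paths per neighbour. For an (s+1)-tuple of
-- neighbours y of w, consider the vertices x linked to all of them; w serves as the subdivision vertex
-- of the edge r a₀, the y's as the side of size s+1, and t linked vertices x with pairwise disjoint links
-- as the side of size t. Convexity bounds the number of (tuple, x, x′) from below. Since the pairs
-- {w, z}, {y, x} and (by Ramsey) {x, x′} may be taken not heavy, all but boundedly many choices of one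
-- coordinate avoid a collision between links, so only a lower order term collides. This gives a
-- contradiction once the degree exceeds both n^(2/5) and n^(s/(2s+2)) by a constant factor.

module Submission where

open import Defs hiding (sym)
open import Data.Bool using (T; if_then_else_)
open import Data.Bool.Properties using (T?)
open import Data.Empty using (⊥)
open import Data.Fin as Fin using (Fin; toℕ; _↑ˡ_; _↑ʳ_; combine)
open import Data.Fin.Properties using (_≟_; combine-injective; remQuot-combine; suc-injective; toℕ-injective; ↑ˡ-injective; ↑ʳ-injective) renaming (any? to anyFin?)
open import Data.List as List using (List; []; _∷_; _++_; length; filter; map; allFin; cartesianProduct; cartesianProductWith)
open import Data.List.Properties using (length-tabulate)
open import Data.List.Membership.Propositional using (_∈_; _∉_; find; lose)
open import Data.List.Membership.Propositional.Properties using (∈-allFin; ∈-cartesianProductWith⁻; ∈-filter⁻; ∈-lookup)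
open import Data.List.Relation.Unary.All as LAll using ([]; _∷_)
open import Data.List.Relation.Unary.AllPairs using (AllPairs; []; _∷_)
import Data.List.Relation.Unary.AllPairs.Properties as AllPairsP
open import Data.List.Relation.Unary.Any using (Any; here; there; any?)
open import Data.List.Relation.Unary.Unique.Propositional using (Unique)
import Data.List.Relation.Unary.Unique.Propositional.Properties as UniqueP
open import Data.Nat using (ℕ; zero; suc; _+_; _*_; _^_; _≤_; _<_; z≤n; s≤s; _≤?_; _<?_; NonZero; >-nonZero; >-nonZero⁻¹)
open import Data.Nat.DivMod using (_/_; _%_; m*n/n≡m; m/n*n≤m; m/n≡0⇒m<n; m%n<n; m≡m%n+[m/n]*n; /-monoˡ-≤)
open import Data.Nat.ListAction using (sum)
open import Data.Nat.Properties hiding (_≟_; suc-injective)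
open import Data.Nat.Tactic.RingSolver using (solve-∀)
open import Data.Product using (Σ; ∃; _×_; _,_; proj₁; proj₂)
open import Data.Sum as Sum using (_⊎_; inj₁; inj₂)
open import Data.Vec using (Vec; []; _∷_; lookup)
open import Data.Vec.Relation.Unary.All as VAll using (All; []; _∷_)
import Data.Vec.Relation.Unary.All.Properties as VAllP
open import Function using (_∘_; id)
open import Relation.Binary.PropositionalEquality using (_≡_; _≢_; refl; sym; trans; cong; cong₂; subst)
open import Relation.Nullary using (¬_; Dec; yes; no; does; contradiction)
open import Relation.Nullary.Decidable using (_×-dec_; _⊎-dec_; ¬?)
open import Relation.Unary using (Decidable)

-- Indicators and sums over lists

-- Write D for the degree of w, κ for the number of extensions guaranteed at either end of a typical
-- edge, and q = s + 1. Convexity over the x's and then over the tuples gives at least a constant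
-- times κ^(4q) D^q / n^(2q-2) triples (tuple, x, x′). The upper bound has two terms: D^q, from
-- tuples with boundedly many linked vertices, and n², from pairs {x, x′} with boundedly many common
-- links. Against the first term D cancels, which yields the threshold n^(s/(2s+2)); against the
-- second D ≥ κ is inserted, which yields n^(2/5). As D may be far larger than κ, w is selected by
-- the number of paths per neighbour: this is what makes both comparisons independent of the size of
-- D. The pairs {x, x′} cannot be made light in the same way as {w, z} and {y, x}, since x and x′
-- lie on different paths. Hence the cliques considered are those of the union of two relations,
-- heavy or free of collisions, and Ramsey's theorem separates the two afterwards.

∑ : {A : Set} → List A → (A → ℕ) → ℕ
∑ xs f = sum (map f xs)

ι : {P : Set} → Dec P → ℕ
ι p = if does p then 1 else 0

ι-mono : {P Q : Set} (p : Dec P) (q : Dec Q) → (P → Q) → ι p ≤ ι q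
ι-mono (no _)  _       _ = z≤n
ι-mono (yes _) (yes _) _ = ≤-refl
ι-mono (yes x) (no ¬q) f = contradiction (f x) ¬q

ι-yes : {P : Set} (p : Dec P) → P → ι p ≡ 1
ι-yes (yes _) _ = refl
ι-yes (no ¬x) x = contradiction x ¬x

ι-× : {P Q : Set} (p : Dec P) (q : Dec Q) → ι (p ×-dec q) ≡ ι p * ι q
ι-× (yes _) (yes _) = refl
ι-× (yes _) (no _)  = refl
ι-× (no _)  _       = refl

ι-¬ : {P : Set} (p : Dec P) → ι p + ι (¬? p) ≡ 1
ι-¬ (yes _) = refl
ι-¬ (no _)  = refl

ι-⊎ : {P Q R : Set} (p : Dec P) (q : Dec Q) (r : Dec R) → (P → Q ⊎ R) → ι p ≤ ι q + ι r
ι-⊎ (no _)  q r h = z≤n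
ι-⊎ (yes x) q r h with h x
... | inj₁ y = ≤-trans (≤-reflexive (sym (ι-yes q y))) (m≤m+n (ι q) (ι r))
... | inj₂ y = ≤-trans (≤-reflexive (sym (ι-yes r y))) (m≤n+m (ι r) (ι q))

-- A case distinction in additive form: in the exceptional case `m` pays for itself. Summed over a
-- list, it charges the exceptional entries separately from the typical ones.
ι-unless : {P : Set} (p : Dec P) {m n : ℕ} → (¬ P → m ≤ n) → m ≤ ι p * m + n
ι-unless (yes _) {m} {n} f = ≤-trans (≤-reflexive (sym (+-identityʳ m))) (m≤m+n (m + 0) n)
ι-unless (no ¬x) f = f ¬x

module _ {A : Set} where

  ∑-mono : ∀ (xs : List A) {f g : A → ℕ} → (∀ {x} → x ∈ xs → f x ≤ g x) → ∑ xs f ≤ ∑ xs g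
  ∑-mono []       _ = z≤n
  ∑-mono (x ∷ xs) h = +-mono-≤ (h (here refl)) (∑-mono xs (h ∘ there))

  ∑-cong : ∀ (xs : List A) {f g : A → ℕ} → (∀ x → f x ≡ g x) → ∑ xs f ≡ ∑ xs g
  ∑-cong []       _ = refl
  ∑-cong (x ∷ xs) h = cong₂ _+_ (h x) (∑-cong xs h)

  ∑-+ : ∀ (xs : List A) (f g : A → ℕ) → ∑ xs (λ x → f x + g x) ≡ ∑ xs f + ∑ xs g
  ∑-+ []       f g = refl
  ∑-+ (x ∷ xs) f g rewrite ∑-+ xs f g = shuffle (f x) (g x) (∑ xs f) (∑ xs g)
    where
    shuffle : ∀ a b c d → a + b + (c + d) ≡ a + c + (b + d)
    shuffle = solve-∀

  ∑-*ˡ : ∀ (xs : List A) c (f : A → ℕ) → ∑ xs (λ x → c * f x) ≡ c * ∑ xs f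
  ∑-*ˡ []       c f = sym (*-zeroʳ c)
  ∑-*ˡ (x ∷ xs) c f rewrite ∑-*ˡ xs c f = sym (*-distribˡ-+ c (f x) (∑ xs f))

  ∑-*ʳ : ∀ (xs : List A) c (f : A → ℕ) → ∑ xs (λ x → f x * c) ≡ ∑ xs f * c
  ∑-*ʳ []       c f = refl
  ∑-*ʳ (x ∷ xs) c f rewrite ∑-*ʳ xs c f = sym (*-distribʳ-+ c (f x) (∑ xs f))

  ∑-const : ∀ (xs : List A) c → ∑ xs (λ _ → c) ≡ length xs * c
  ∑-const []       c = refl
  ∑-const (x ∷ xs) c = cong (c +_) (∑-const xs c)

  ∑-++ : ∀ (xs ys : List A) (f : A → ℕ) → ∑ (xs ++ ys) f ≡ ∑ xs f + ∑ ys f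
  ∑-++ []       ys f = refl
  ∑-++ (x ∷ xs) ys f rewrite ∑-++ xs ys f = sym (+-assoc (f x) (∑ xs f) (∑ ys f))

  ∑-map : {B : Set} (h : B → A) (ys : List B) (f : A → ℕ) → ∑ (map h ys) f ≡ ∑ ys (λ y → f (h y))
  ∑-map h []       f = refl
  ∑-map h (y ∷ ys) f = cong (f (h y) +_) (∑-map h ys f)

∑-swap : {A B : Set} (xs : List A) (ys : List B) (f : A → B → ℕ) →
         ∑ xs (λ x → ∑ ys (f x)) ≡ ∑ ys (λ y → ∑ xs (λ x → f x y))
∑-swap []       ys f = sym (trans (∑-const ys 0) (*-zeroʳ (length ys)))
∑-swap (x ∷ xs) ys f =
  trans (cong (∑ ys (f x) +_) (∑-swap xs ys f)) (sym (∑-+ ys (f x) (λ y → ∑ xs (λ x → f x y))))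

∑-product : {A B C : Set} (h : A → B → C) (xs : List A) (ys : List B) (f : C → ℕ) →
            ∑ (cartesianProductWith h xs ys) f ≡ ∑ xs (λ x → ∑ ys (λ y → f (h x y)))
∑-product h []       ys f = refl
∑-product h (x ∷ xs) ys f =
  trans (∑-++ (map (h x) ys) (cartesianProductWith h xs ys) f)
        (cong₂ _+_ (∑-map (h x) ys f) (∑-product h xs ys f))

module _ {A : Set} where

  module _ {P : A → Set} (P? : Decidable P) where

    ∑-filter : ∀ (xs : List A) (f : A → ℕ) → ∑ (filter P? xs) f ≡ ∑ xs (λ x → ι (P? x) * f x)
    ∑-filter []       f = refl
    ∑-filter (x ∷ xs) f with P? x
    ... | yes _ = cong₂ _+_ (sym (+-identityʳ (f x))) (∑-filter xs f)
    ... | no  _ = ∑-filter xs f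

    length-filter-∑ : ∀ (xs : List A) → length (filter P? xs) ≡ ∑ xs (λ x → ι (P? x))
    length-filter-∑ []       = refl
    length-filter-∑ (x ∷ xs) with P? x
    ... | yes _ = cong suc (length-filter-∑ xs)
    ... | no  _ = length-filter-∑ xs

    ∑-filter-≤ : ∀ (xs : List A) (f : A → ℕ) → ∑ (filter P? xs) f ≤ ∑ xs f
    ∑-filter-≤ []       f = z≤n
    ∑-filter-≤ (x ∷ xs) f with P? x
    ... | yes _ = +-monoʳ-≤ (f x) (∑-filter-≤ xs f)
    ... | no  _ = ≤-trans (∑-filter-≤ xs f) (m≤n+m (∑ xs f) (f x))

    ∑-split : ∀ (xs : List A) → ∑ xs (λ x → ι (P? x)) + ∑ xs (λ x → ι (¬? (P? x))) ≡ length xs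
    ∑-split xs = trans (sym (∑-+ xs _ _)) (trans (∑-cong xs (λ x → ι-¬ (P? x)))
                       (trans (∑-const xs 1) (*-identityʳ (length xs))))

    ∑-ι-pos : ∀ {xs : List A} {x} → x ∈ xs → P x → 1 ≤ ∑ xs (λ x → ι (P? x))
    ∑-ι-pos {x ∷ xs} (here refl) px rewrite ι-yes (P? x) px = s≤s z≤n
    ∑-ι-pos {y ∷ xs} (there m)   px = ≤-trans (∑-ι-pos m px) (m≤n+m _ (ι (P? y)))

    ι-∃ : {Q : Set} (q : Dec Q) (xs : List A) → (Q → ∃ λ x → x ∈ xs × P x) → ι q ≤ ∑ xs (λ x → ι (P? x))
    ι-∃ (no _)  xs h = z≤n
    ι-∃ (yes v) xs h with x , x∈ , px ← h v = ∑-ι-pos x∈ px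

  ∑-pick : ∀ (xs : List A) (f g : A → ℕ) → 0 < length xs → ∑ xs f ≤ ∑ xs g → ∃ λ x → x ∈ xs × f x ≤ g x
  ∑-pick (x ∷ xs) f g _ h with f x ≤? g x
  ... | yes p = x , here refl , p
  ∑-pick (x ∷ [])         f g _ h | no ¬p = contradiction (subst (_≤ _) (+-identityʳ (f x)) (≤-trans h (≤-reflexive (+-identityʳ (g x))))) ¬p
  ∑-pick (x ∷ xs@(_ ∷ _)) f g _ h | no ¬p
    with y , y∈ , q ← ∑-pick xs f g (s≤s z≤n)
           (+-cancelˡ-≤ (g x) _ _ (≤-trans (+-monoˡ-≤ (∑ xs f) (<⇒≤ (≰⇒> ¬p))) h))
    = y , there y∈ , q

-- Convexity: Chebyshev's sum inequality and power means

rearrangement : ∀ a b q → a * b ^ q + b * a ^ q ≤ a ^ suc q + b ^ suc q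
rearrangement a b q with ≤-total a b
-- With `b = a + c` and `b ^ q = a ^ q + E`, the two sides differ by `c * E`, which is (b - a)(b^q -
-- a^q).
... | inj₁ a≤b with c , refl ← m≤n⇒∃[o]m+o≡n a≤b | E , eq ← m≤n⇒∃[o]m+o≡n (^-monoˡ-≤ q a≤b) =
  subst (λ B → a * B + (a + c) * a ^ q ≤ a * a ^ q + (a + c) * B) eq
    (≤-trans (m≤m+n _ (c * E)) (≤-reflexive (identity a c (a ^ q) E)))
  where
  identity : ∀ a c A E → a * (A + E) + (a + c) * A + c * E ≡ a * A + (a + c) * (A + E)
  identity = solve-∀
... | inj₂ b≤a with c , refl ← m≤n⇒∃[o]m+o≡n b≤a | E , eq ← m≤n⇒∃[o]m+o≡n (^-monoˡ-≤ q b≤a) =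
  subst (λ A → (b + c) * b ^ q + b * A ≤ (b + c) * A + b * b ^ q) eq
    (≤-trans (m≤m+n _ (c * E)) (≤-reflexive (identity b c (b ^ q) E)))
  where
  identity : ∀ b c B E → (b + c) * B + b * (B + E) + c * E ≡ (b + c) * (B + E) + b * B
  identity = solve-∀

module _ {A : Set} (xs : List A) (f : A → ℕ) where

  open ≤-Reasoning

  -- Sum `rearrangement` over all ordered pairs of entries. The factor 2 allows both sides to be
  -- symmetrised, so the list need not be sorted.
  chebyshev : ∀ q → ∑ xs f * ∑ xs (λ x → f x ^ q) ≤ length xs * ∑ xs (λ x → f x ^ suc q)
  chebyshev q = *-cancelˡ-≤ 2 (begin
    2 * (∑ xs f * ∑ xs (λ x → f x ^ q))
      ≡⟨ cong (2 *_) (expand f (λ x → f x ^ q)) ⟩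
    2 * ∑ xs (λ x → ∑ xs (λ y → f x * f y ^ q))
      ≡⟨ double (λ x y → f x * f y ^ q) ⟩
    ∑ xs (λ x → ∑ xs (λ y → f x * f y ^ q + f y * f x ^ q))
      ≤⟨ ∑-mono xs (λ {x} _ → ∑-mono xs (λ {y} _ → rearrangement (f x) (f y) q)) ⟩
    ∑ xs (λ x → ∑ xs (λ y → f x ^ suc q + f y ^ suc q))
      ≡⟨ double (λ x y → f x ^ suc q) ⟨
    2 * ∑ xs (λ x → ∑ xs (λ y → f x ^ suc q))
      ≡⟨ cong (2 *_) (trans (∑-cong xs (λ x → ∑-const xs (f x ^ suc q))) (∑-*ˡ xs (length xs) _)) ⟩
    2 * (length xs * ∑ xs (λ x → f x ^ suc q)) ∎)
    where
    expand : ∀ g h → ∑ xs g * ∑ xs h ≡ ∑ xs (λ x → ∑ xs (λ y → g x * h y))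
    expand g h = trans (sym (∑-*ʳ xs (∑ xs h) g)) (∑-cong xs (λ x → sym (∑-*ˡ xs (g x) h)))
    double : ∀ F → 2 * ∑ xs (λ x → ∑ xs (F x)) ≡ ∑ xs (λ x → ∑ xs (λ y → F x y + F y x))
    double F = trans (cong (∑ xs (λ x → ∑ xs (F x)) +_) (trans (+-identityʳ _) (∑-swap xs xs F)))
      (trans (sym (∑-+ xs _ _)) (∑-cong xs (λ x → sym (∑-+ xs (F x) (λ y → F y x)))))

  powerMean : ∀ q → ∑ xs f ^ suc q ≤ length xs ^ q * ∑ xs (λ x → f x ^ suc q)
  powerMean zero    = ≤-reflexive (trans (*-identityʳ _) (sym (trans (+-identityʳ _) (∑-cong xs (λ x → *-identityʳ (f x))))))
  powerMean (suc q) = begin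
    ∑ xs f * ∑ xs f ^ suc q
      ≤⟨ *-monoʳ-≤ (∑ xs f) (powerMean q) ⟩
    ∑ xs f * (length xs ^ q * ∑ xs (λ x → f x ^ suc q))
      ≡⟨ rotate (∑ xs f) (length xs ^ q) _ ⟩
    length xs ^ q * (∑ xs f * ∑ xs (λ x → f x ^ suc q))
      ≤⟨ *-monoʳ-≤ (length xs ^ q) (chebyshev (suc q)) ⟩
    length xs ^ q * (length xs * ∑ xs (λ x → f x ^ suc (suc q)))
      ≡⟨ trans (rotate (length xs ^ q) (length xs) _) (sym (*-assoc (length xs) (length xs ^ q) _)) ⟩
    length xs ^ suc q * ∑ xs (λ x → f x ^ suc (suc q)) ∎
    where
    rotate : ∀ a b c → a * (b * c) ≡ b * (a * c)
    rotate = solve-∀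

-- Tuples with entries in a list

tuples : {A : Set} → List A → (q : ℕ) → List (Vec A q)
tuples S zero    = [] ∷ []
tuples S (suc q) = cartesianProductWith _∷_ S (tuples S q)

module _ {A : Set} where

  ∑-tuples : ∀ (S : List A) q (f : Vec A (suc q) → ℕ) →
             ∑ (tuples S (suc q)) f ≡ ∑ S (λ y → ∑ (tuples S q) (λ v → f (y ∷ v)))
  ∑-tuples S q f = ∑-product _∷_ S (tuples S q) f

  length-tuples : ∀ (S : List A) q → length (tuples S q) ≡ length S ^ q
  length-tuples S q = trans (sym (trans (∑-const (tuples S q) 1) (*-identityʳ _))) (go q)
    where
    go : ∀ q → ∑ (tuples S q) (λ _ → 1) ≡ length S ^ q
    go zero    = refl
    go (suc q) = trans (∑-tuples S q _) (trans (∑-const S _) (cong (length S *_) (go q)))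

  -- This turns the number of tuples linked entrywise to `x`, or to both `x` and `x′`, into a power
  -- of `d x` or `d₂ x x′`.
  ∑-tuples-filter : ∀ {P : A → Set} (P? : Decidable P) (S : List A) q (f : Vec A q → ℕ) →
    ∑ (tuples S q) (λ v → ι (VAll.all? P? v) * f v) ≡ ∑ (tuples (filter P? S) q) f
  ∑-tuples-filter P? S zero    f = cong (_+ 0) (+-identityʳ (f []))
  ∑-tuples-filter P? S (suc q) f =
    trans (∑-tuples S q _)
    (trans (∑-cong S (λ y → trans (∑-cong (tuples S q) (λ v → step y v))
             (trans (∑-*ˡ (tuples S q) (ι (P? y)) _) (cong (ι (P? y) *_) (∑-tuples-filter P? S q (λ v → f (y ∷ v)))))))
    (trans (sym (∑-filter P? S _)) (sym (∑-tuples (filter P? S) q f))))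
    where
    step : ∀ y v → ι (VAll.all? P? (y ∷ v)) * f (y ∷ v) ≡ ι (P? y) * (ι (VAll.all? P? v) * f (y ∷ v))
    step y v with P? y | VAll.all? P? v
    ... | yes _ | yes _ = sym (+-identityʳ _)
    ... | yes _ | no  _ = refl
    ... | no  _ | _     = refl

-- Cliques

-- Distinctness of the members is left to `R`: the relations used for embeddings, `Heavy` and
-- `Compatible`, both contain it.
Clique : {A : Set} → (A → A → Set) → ℕ → List A → Set
Clique {A} R j X = Σ (List A) λ C → length C ≡ j × LAll.All (_∈ X) C × AllPairs R C

module _ {A : Set} where

  Clique-filter : ∀ {R : A → A → Set} {P : A → Set} (P? : Decidable P) {j X} →
                  Clique R j (filter P? X) → Clique R j X
  Clique-filter P? (C , l , C⊆ , r) = C , l , LAll.map (proj₁ ∘ ∈-filter⁻ P?) C⊆ , r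

  Clique-∷ : ∀ {R : A → A → Set} {P : A → Set} (P? : Decidable P) {j X} y → (∀ {x} → P x → R y x) →
             Clique R j (filter P? X) → Clique R (suc j) (y ∷ X)
  Clique-∷ P? {X = X} y h (C , l , C⊆ , r) =
    y ∷ C , cong suc l , here refl ∷ LAll.map (there ∘ proj₁ ∘ ∈-filter⁻ P?) C⊆ ,
    LAll.map (h ∘ proj₂ ∘ ∈-filter⁻ P? {xs = X}) C⊆ ∷ r

  lookup-AllPairs : ∀ {R : A → A → Set} → (∀ {x y} → R x y → R y x) → ∀ {C} → AllPairs R C →
                    ∀ i j → i ≢ j → R (List.lookup C i) (List.lookup C j)
  lookup-AllPairs s (p ∷ ps) Fin.zero    Fin.zero    n = contradiction refl n
  lookup-AllPairs s (p ∷ ps) Fin.zero    (Fin.suc j) n = LAll.lookup p (∈-lookup j)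
  lookup-AllPairs s (p ∷ ps) (Fin.suc i) Fin.zero    n = s (LAll.lookup p (∈-lookup i))
  lookup-AllPairs s (p ∷ ps) (Fin.suc i) (Fin.suc j) n = lookup-AllPairs s ps i j (n ∘ cong Fin.suc)

  -- The argument of Erdős and Szekeres: the threshold halves whenever `a` or `b` drops by one, so
  -- among the entries after `x` either those in relation `P` to `x` or the others reach the halved
  -- threshold. The others are in relation `Q` to `x` by hypothesis, so only `P` is decided.
  ramsey : ∀ {P Q : A → A → Set} (P? : ∀ x y → Dec (P x y)) a b X →
           AllPairs (λ x y → P x y ⊎ Q x y) X → 2 ^ (a + b) ≤ length X → Clique P a X ⊎ Clique Q b X
  ramsey P? zero    b       X        R _ = inj₁ ([] , refl , [] , [])
  ramsey P? (suc a) zero    X        R _ = inj₂ ([] , refl , [] , [])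
  ramsey P? (suc a) (suc b) []       R h = contradiction h (<⇒≱ (m^n>0 2 (suc a + suc b)))
  ramsey {P} {Q} P? (suc a) (suc b) (x ∷ X) (Rx ∷ R) h with 2 ^ (a + suc b) ≤? length (filter (P? x) X)
  ... | yes big with ramsey P? a (suc b) (filter (P? x) X) (AllPairsP.filter⁺ (P? x) R) big
  ...   | inj₁ c = inj₁ (Clique-∷ (P? x) x id c)
  ...   | inj₂ (C , l , C⊆ , r) = inj₂ (C , l , LAll.map (there ∘ proj₁ ∘ ∈-filter⁻ (P? x)) C⊆ , r)
  ramsey {P} {Q} P? (suc a) (suc b) (x ∷ X) (Rx ∷ R) h | no ¬big
    with ramsey P? (suc a) b (filter (¬? ∘ P? x) X) (AllPairsP.filter⁺ (¬? ∘ P? x) R) big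
    where
    parts : length (filter (P? x) X) + length (filter (¬? ∘ P? x) X) ≡ length X
    parts = trans (cong₂ _+_ (length-filter-∑ (P? x) X) (length-filter-∑ (¬? ∘ P? x) X)) (∑-split (P? x) X)
    big : 2 ^ (suc a + b) ≤ length (filter (¬? ∘ P? x) X)
    big with 2 ^ (suc a + b) ≤? length (filter (¬? ∘ P? x) X)
    ... | yes p = p
    ... | no ¬p = contradiction h (<⇒≱ (begin
      suc (suc (length X))
        ≡⟨ cong suc (trans (+-suc _ _) (cong suc parts)) ⟨
      suc (length (filter (P? x) X)) + suc (length (filter (¬? ∘ P? x) X))
        ≤⟨ +-mono-≤ (≰⇒> ¬big) (≰⇒> ¬p) ⟩
      2 ^ (a + suc b) + 2 ^ (suc a + b)
        ≡⟨ cong (2 ^ (a + suc b) +_) (trans (cong (2 ^_) (sym (+-suc a b))) (sym (+-identityʳ _))) ⟩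
      2 ^ (suc a + suc b) ∎))
      where open ≤-Reasoning
  ...   | inj₁ (C , l , C⊆ , r) = inj₁ (C , l , LAll.map (there ∘ proj₁ ∘ ∈-filter⁻ (¬? ∘ P? x)) C⊆ , r)
  ...   | inj₂ (C , l , C⊆ , r) = inj₂ (x ∷ C , cong suc l , here refl ∷ LAll.map (there ∘ proj₁ ∘ ∈-filter⁻ (¬? ∘ P? x)) C⊆ ,
                                        LAll.map related C⊆ ∷ r)
    where
    related : ∀ {y} → y ∈ filter (¬? ∘ P? x) X → Q x y
    related y∈ with y∈X , ¬p ← ∈-filter⁻ (¬? ∘ P? x) {xs = X} y∈ | LAll.lookup Rx (proj₁ (∈-filter⁻ (¬? ∘ P? x) y∈))
    ... | inj₁ p = contradiction p ¬p
    ... | inj₂ q = q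

module _ {A : Set} {R : A → A → Set} (R? : ∀ x y → Dec (R x y)) where

  open ≤-Reasoning

  -- For irreflexive `R` an entry `y` counts itself; later bounds treat this diagonal term
  -- separately.
  non : List A → A → ℕ
  non X y = ∑ X (λ x → ι (¬? (R? y x)))

  -- Each passage to the `R`-neighbours of the first entry costs at most `q` entries, so `j`
  -- passages leave a nonempty list.
  greedyClique : ∀ j q Z → (∀ {y} → y ∈ Z → non Z y ≤ q) → j * q < length Z → Clique R (suc j) Z
  greedyClique zero    q (y ∷ Z) _ _ = y ∷ [] , refl , here refl ∷ [] , [] ∷ []
  greedyClique (suc j) q Z@(y ∷ Z′) few big =
    let C , l , C⊆ , r = greedyClique j q (filter (R? y) Z)
                           (λ x∈ → ≤-trans (∑-filter-≤ (R? y) Z _) (few (proj₁ (∈-filter⁻ (R? y) {xs = Z} x∈))))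
                           smaller
    in y ∷ C , cong suc l , here refl ∷ LAll.map (proj₁ ∘ ∈-filter⁻ (R? y) {xs = Z}) C⊆ ,
       LAll.map (proj₂ ∘ ∈-filter⁻ (R? y) {xs = Z}) C⊆ ∷ r
    where
    smaller : j * q < length (filter (R? y) Z)
    smaller = +-cancelˡ-< q _ _ (begin-strict
      q + j * q                                   <⟨ big ⟩
      length Z                                    ≡⟨ ∑-split (R? y) Z ⟨
      ∑ Z (λ x → ι (R? y x)) + non Z y            ≤⟨ +-monoʳ-≤ _ (few (here refl)) ⟩
      ∑ Z (λ x → ι (R? y x)) + q                  ≡⟨ cong (_+ q) (length-filter-∑ (R? y) Z) ⟨
      length (filter (R? y) Z) + q                ≡⟨ +-comm _ q ⟩
      q + length (filter (R? y) Z)                ∎)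

  Low? : ∀ h X x → Dec (h * non X x ≤ length X)
  Low? h X x = h * non X x ≤? length X

  -- A low entry has at most `length X / (8 * suc j)` non-neighbours. More than `j` times that many
  -- low entries would contain a clique by `greedyClique`, so fewer than one in eight are low unless
  -- `X` is empty.
  few-low : ∀ j X → ¬ Clique R (suc j) X → 8 * ∑ X (λ x → ι (Low? (8 * suc j) X x)) ≤ length X
  few-low j X none with length (filter (Low? (8 * suc j) X) X) ≤? j * (length X / (8 * suc j))
  ... | yes p = begin
    8 * ∑ X (λ x → ι (Low? (8 * suc j) X x))    ≡⟨ cong (8 *_) (length-filter-∑ (Low? (8 * suc j) X) X) ⟨
    8 * length (filter (Low? (8 * suc j) X) X)  ≤⟨ *-monoʳ-≤ 8 p ⟩
    8 * (j * q)                                 ≤⟨ *-monoʳ-≤ 8 (*-monoˡ-≤ q (n≤1+n j)) ⟩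
    8 * (suc j * q)                             ≡⟨ trans (sym (*-assoc 8 (suc j) q)) (*-comm (8 * suc j) q) ⟩
    q * (8 * suc j)                             ≤⟨ m/n*n≤m (length X) (8 * suc j) ⟩
    length X                                    ∎
    where q = length X / (8 * suc j)
  ... | no ¬p = contradiction (Clique-filter (Low? (8 * suc j) X)
                  (greedyClique j _ (filter (Low? (8 * suc j) X) X) few (≰⇒> ¬p))) none
    where
    few : ∀ {y} → y ∈ filter (Low? (8 * suc j) X) X →
          non (filter (Low? (8 * suc j) X) X) y ≤ length X / (8 * suc j)
    few {y} y∈ = begin
      non (filter (Low? (8 * suc j) X) X) y   ≤⟨ ∑-filter-≤ (Low? (8 * suc j) X) X _ ⟩
      non X y                                 ≡⟨ m*n/n≡m (non X y) (8 * suc j) ⟨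
      non X y * (8 * suc j) / (8 * suc j)     ≤⟨ /-monoˡ-≤ (8 * suc j) (≤-trans (≤-reflexive (*-comm (non X y) (8 * suc j)))
                                                  (proj₂ (∈-filter⁻ (Low? (8 * suc j) X) {xs = X} y∈))) ⟩
      length X / (8 * suc j)                  ∎

  -- A supersaturated Turán bound: at least seven eighths of the entries are not low, and each of
  -- these has more than `length X / (8 * suc j)` non-neighbours.
  many-non : ∀ j X → ¬ Clique R (suc j) X → 7 * (length X * length X) ≤ 8 * (8 * suc j * ∑ X (non X))
  many-non j X none = +-cancelˡ-≤ (ℓ * ℓ) _ _ (begin
    ℓ * ℓ + 7 * (ℓ * ℓ)
      ≡⟨ eight ℓ ⟩
    8 * (ℓ * ℓ)
      ≡⟨ cong (8 *_) (∑-const X ℓ) ⟨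
    8 * ∑ X (λ _ → ℓ)
      ≤⟨ *-monoʳ-≤ 8 (∑-mono X (λ {x} _ → bound x)) ⟩
    8 * ∑ X (λ x → ι (Low? h X x) * ℓ + h * non X x)
      ≡⟨ cong (8 *_) (trans (∑-+ X _ _) (cong₂ _+_ (∑-*ʳ X ℓ _) (∑-*ˡ X h _))) ⟩
    8 * (∑ X (λ x → ι (Low? h X x)) * ℓ + h * ∑ X (non X))
      ≡⟨ distr (∑ X (λ x → ι (Low? h X x))) ℓ (h * ∑ X (non X)) ⟩
    8 * ∑ X (λ x → ι (Low? h X x)) * ℓ + 8 * (h * ∑ X (non X))
      ≤⟨ +-monoˡ-≤ _ (*-monoˡ-≤ ℓ (few-low j X none)) ⟩
    ℓ * ℓ + 8 * (h * ∑ X (non X)) ∎)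
    where
    ℓ = length X
    h = 8 * suc j
    eight : ∀ ℓ → ℓ * ℓ + 7 * (ℓ * ℓ) ≡ 8 * (ℓ * ℓ)
    eight = solve-∀
    distr : ∀ a l b → 8 * (a * l + b) ≡ 8 * a * l + 8 * b
    distr = solve-∀
    bound : ∀ x → ℓ ≤ ι (Low? h X x) * ℓ + h * non X x
    bound x = ι-unless (Low? h X x) (λ ¬p → <⇒≤ (≰⇒> ¬p))

clique-tuple : {A : Set} {R : A → A → Set} → (∀ {x y} → R x y → R y x) → ∀ {j X} → Clique R j X →
               Σ (Fin j → A) λ c → (∀ i → c i ∈ X) × (∀ i i′ → i ≢ i′ → R (c i) (c i′))
clique-tuple sy (C , refl , C⊆ , r) = List.lookup C , (λ i → LAll.lookup C⊆ (∈-lookup i)) , lookup-AllPairs sy r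

-- Systems of distinct representatives

module _ {n : ℕ} where

  ∑-≡ : ∀ {xs : List (Fin n)} → Unique xs → ∀ a → ∑ xs (λ x → ι (x ≟ a)) ≤ 1
  ∑-≡ []                   a = z≤n
  ∑-≡ {x ∷ xs} (x∉ ∷ uniq) a with x ≟ a
  ... | no  _    = ∑-≡ uniq a
  ... | yes refl = s≤s (≤-trans (∑-mono xs (λ {y} y∈ → ι-mono (y ≟ x) (no id) (λ y≡x → LAll.lookup x∉ y∈ (sym y≡x))))
                                (≤-reflexive (trans (∑-const xs 0) (*-zeroʳ (length xs)))))

  pick : ∀ (avoid : List (Fin n)) {xs} → Unique xs → length avoid < length xs → ∃ λ x → x ∈ xs × x ∉ avoid
  pick []          {x ∷ xs} _    _   = x , here refl , λ ()
  pick (a ∷ avoid) {xs}     uniq big =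
    let x , x∈ , x∉ = pick avoid (UniqueP.filter⁺ (λ x → ¬? (x ≟ a)) uniq) smaller
        x∈xs , x≢a  = ∈-filter⁻ (λ x → ¬? (x ≟ a)) {xs = xs} x∈
    in x , x∈xs , λ { (here x≡a) → x≢a x≡a ; (there x∈a) → x∉ x∈a }
    where
    open ≤-Reasoning
    smaller : length avoid < length (filter (λ x → ¬? (x ≟ a)) xs)
    smaller = +-cancelˡ-≤ 1 _ _ (begin
      1 + suc (length avoid)                                             ≤⟨ big ⟩
      length xs                                                          ≡⟨ ∑-split (_≟ a) xs ⟨
      ∑ xs (λ x → ι (x ≟ a)) + ∑ xs (λ x → ι (¬? (x ≟ a)))               ≤⟨ +-monoˡ-≤ _ (∑-≡ uniq a) ⟩
      1 + ∑ xs (λ x → ι (¬? (x ≟ a)))                                    ≡⟨ cong suc (length-filter-∑ (λ x → ¬? (x ≟ a)) xs) ⟨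
      1 + length (filter (λ x → ¬? (x ≟ a)) xs)                          ∎)

  -- A greedy choice. Each chosen vertex moves to `avoid`, so `J + length avoid` is constant along
  -- the recursion.
  distinctRepresentatives : ∀ J (cand : Fin J → List (Fin n)) (avoid : List (Fin n)) →
    (∀ i → Unique (cand i)) → (∀ i → J + length avoid ≤ length (cand i)) →
    Σ (Fin J → Fin n) λ f → (∀ {i j} → f i ≡ f j → i ≡ j) × (∀ i → f i ∈ cand i) × (∀ i → f i ∉ avoid)
  distinctRepresentatives zero    cand avoid uniq big = (λ ()) , (λ {i} → λ { {()} }) , (λ ()) , (λ ())
  distinctRepresentatives (suc J) cand avoid uniq big
    with v , v∈ , v∉ ← pick avoid (uniq Fin.zero) (≤-trans (s≤s (m≤n+m _ J)) (big Fin.zero))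
    with f , inj , f∈ , f∉ ← distinctRepresentatives J (cand ∘ Fin.suc) (v ∷ avoid) (uniq ∘ Fin.suc)
                               (λ i → ≤-trans (≤-reflexive (+-suc J _)) (big (Fin.suc i)))
    = f′ , inj′ , f′∈ , f′∉
    where
    f′ : Fin (suc J) → Fin n
    f′ Fin.zero    = v
    f′ (Fin.suc i) = f i
    inj′ : ∀ {i j} → f′ i ≡ f′ j → i ≡ j
    inj′ {Fin.zero}  {Fin.zero}  _  = refl
    inj′ {Fin.zero}  {Fin.suc j} eq = contradiction (here (sym eq)) (f∉ j)
    inj′ {Fin.suc i} {Fin.zero}  eq = contradiction (here eq) (f∉ i)
    inj′ {Fin.suc i} {Fin.suc j} eq = cong Fin.suc (inj eq)
    f′∈ : ∀ i → f′ i ∈ cand i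
    f′∈ Fin.zero    = v∈
    f′∈ (Fin.suc i) = f∈ i
    f′∉ : ∀ i → f′ i ∉ avoid
    f′∉ Fin.zero    = v∉
    f′∉ (Fin.suc i) = f∉ i ∘ there

-- Embeddings of the subdivision

module Graph {n : ℕ} (G : SimpleGraph n) where

  V : Set
  V = Fin n

  infix 4 _~_ _~?_

  _~_ : V → V → Set
  x ~ y = T (adj G x y)

  _~?_ : ∀ x y → Dec (x ~ y)
  x ~? y = T? (adj G x y)

  ~-sym : ∀ {x y} → x ~ y → y ~ x
  ~-sym {x} {y} = subst T (SimpleGraph.sym G x y)

  deg : List V → V → ℕ
  deg Z v = ∑ Z (λ u → ι (v ~? u))

  ι-~-sym : ∀ x y → ι (x ~? y) ≡ ι (y ~? x)
  ι-~-sym x y = cong (λ b → ι (T? b)) (SimpleGraph.sym G x y)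

  -- The vertex `y zero` plays r, the other `y`'s form the s-part, and `w` subdivides the edge r a₀.
  -- `Side` separates branch vertices from subdivision vertices, so injectivity reduces to each of
  -- the two classes.
  embedding : ∀ {s t} {Side : V → Set} (y : Fin (suc s) → V) (x : Fin t → V) (w : V) (z : Fin (suc s) → Fin t → V) →
    (∀ {i j} → y i ≡ y j → i ≡ j) → (∀ {i j} → x i ≡ x j → i ≡ j) → (∀ i j → y i ≢ x j) →
    (∀ {i j i′ j′} → z i j ≡ z i′ j′ → i ≡ i′ × j ≡ j′) → (∀ i j → w ≢ z i j) →
    (∀ i → Side (y i)) → (∀ j → Side (x j)) → ¬ Side w → (∀ i j → ¬ Side (z i j)) →
    (∀ i j → y i ~ z i j) → (∀ i j → z i j ~ x j) → y Fin.zero ~ w → (∀ a → toℕ a ≡ 0 → w ~ y (Fin.suc a)) →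
    Contains G (subdivision (Kplus s t))
  embedding {s} {t} {Side} y x w z y-inj x-inj y≢x z-inj w≢z Sy Sx ¬Sw ¬Sz y~z z~x y~w w~y =
    φ , (λ {u} {v} → inj u v) , edges
    where
    φ₁ : KVtx s t → V
    φ₁ (aV a) = y (Fin.suc a)
    φ₁ (bV b) = x b
    φ₁ rV     = y Fin.zero
    φ₂ : KEdg s t → V
    φ₂ (ab a b) = z (Fin.suc a) b
    φ₂ (ra _ _) = w
    φ₂ (rb b)   = z Fin.zero b
    φ : KVtx s t ⊎ KEdg s t → V
    φ (inj₁ v) = φ₁ v
    φ (inj₂ e) = φ₂ e
    side₁ : ∀ v → Side (φ₁ v)
    side₁ (aV a) = Sy (Fin.suc a)
    side₁ (bV b) = Sx b
    side₁ rV     = Sy Fin.zero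
    side₂ : ∀ e → ¬ Side (φ₂ e)
    side₂ (ab a b) = ¬Sz (Fin.suc a) b
    side₂ (ra _ _) = ¬Sw
    side₂ (rb b)   = ¬Sz Fin.zero b
    inj₁′ : ∀ u v → φ₁ u ≡ φ₁ v → u ≡ v
    inj₁′ (aV a) (aV b) eq = cong aV (suc-injective (y-inj eq))
    inj₁′ (aV a) (bV b) eq = contradiction eq (y≢x _ _)
    inj₁′ (aV a) rV     eq with () ← y-inj eq
    inj₁′ (bV a) (aV b) eq = contradiction (sym eq) (y≢x _ _)
    inj₁′ (bV a) (bV b) eq = cong bV (x-inj eq)
    inj₁′ (bV a) rV     eq = contradiction (sym eq) (y≢x _ _)
    inj₁′ rV     (aV b) eq with () ← y-inj eq
    inj₁′ rV     (bV b) eq = contradiction eq (y≢x _ _)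
    inj₁′ rV     rV     eq = refl
    inj₂′ : ∀ u v → φ₂ u ≡ φ₂ v → u ≡ v
    inj₂′ (ab a b) (ab c d) eq with refl , refl ← z-inj eq = refl
    inj₂′ (ab a b) (ra c p) eq = contradiction (sym eq) (w≢z _ _)
    inj₂′ (ab a b) (rb d)   eq with () ← proj₁ (z-inj eq)
    inj₂′ (ra a p) (ab c d) eq = contradiction eq (w≢z _ _)
    -- Both indices equal 0, and the proofs of this carried by the edges agree because equality in ℕ
    -- is proof-irrelevant.
    inj₂′ (ra a p) (ra c q) eq with refl ← toℕ-injective {i = a} {j = c} (trans p (sym q)) = cong (ra a) (≡-irrelevant p q)
    inj₂′ (ra a p) (rb d)   eq = contradiction eq (w≢z _ _)
    inj₂′ (rb b)   (ab c d) eq with () ← proj₁ (z-inj eq)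
    inj₂′ (rb b)   (ra c p) eq = contradiction (sym eq) (w≢z _ _)
    inj₂′ (rb b)   (rb d)   eq = cong rb (proj₂ (z-inj eq))
    inj : ∀ u v → φ u ≡ φ v → u ≡ v
    inj (inj₁ u) (inj₁ v) eq = cong inj₁ (inj₁′ u v eq)
    inj (inj₁ u) (inj₂ e) eq = contradiction (subst Side eq (side₁ u)) (side₂ e)
    inj (inj₂ e) (inj₁ u) eq = contradiction (subst Side (sym eq) (side₁ u)) (side₂ e)
    inj (inj₂ e) (inj₂ f) eq = cong inj₂ (inj₂′ e f eq)
    edges : ∀ e → φ (end₁ (subdivision (Kplus s t)) e) ~ φ (end₂ (subdivision (Kplus s t)) e)
    edges (first (ab a b))  = y~z (Fin.suc a) b
    edges (first (ra a p))  = y~w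
    edges (first (rb b))    = y~z Fin.zero b
    edges (second (ab a b)) = z~x (Fin.suc a) b
    edges (second (ra a p)) = w~y a p
    edges (second (rb b))   = z~x Fin.zero b

  Common? : ∀ x y z → Dec (x ~ z × y ~ z)
  Common? x y z = (x ~? z) ×-dec (y ~? z)

  codeg : List V → V → V → ℕ
  codeg Z x y = ∑ Z (λ z → ι (Common? x y z))

  codeg-sym : ∀ Z x y → codeg Z x y ≤ codeg Z y x
  codeg-sym Z x y = ∑-mono Z (λ {z} _ → ι-mono (Common? x y z) (Common? y x z) (λ (p , q) → q , p))

  Heavy : ℕ → List V → V → V → Set
  Heavy L Z x y = x ≢ y × L ≤ codeg Z x y

  Heavy? : ∀ L Z x y → Dec (Heavy L Z x y)
  Heavy? L Z x y = ¬? (x ≟ y) ×-dec (L ≤? codeg Z x y)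

  Heavy-sym : ∀ {L Z x y} → Heavy L Z x y → Heavy L Z y x
  Heavy-sym {Z = Z} {x} {y} (x≢y , h) = x≢y ∘ sym , ≤-trans h (codeg-sym Z x y)

  -- The heaviness threshold is the number of edges of `Kplus (suc s) t`, and the clique size is its
  -- number of vertices. Any placement of the branch vertices in the clique then leaves enough
  -- common neighbours for distinct midpoints.
  heavyClique⇒contains : ∀ s t {X Z} → Unique Z → (∀ {v} → v ∈ X → v ∉ Z) →
    Clique (Heavy (suc (suc (suc s) * t)) Z) (suc (suc s) + t) X → Contains G (subdivision (Kplus (suc s) t))
  heavyClique⇒contains s t {X} {Z} uniq disjoint clique
    with c , c∈ , heavy ← clique-tuple (Heavy-sym {Z = Z}) clique =
    embedding {Side = _∈ X} y x (f Fin.zero) (λ i j → f (Fin.suc (combine i j)))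
      (λ {i} {j} eq → ↑ˡ-injective t i j (c-inj eq)) (λ {i} {j} eq → ↑ʳ-injective (suc (suc s)) i j (c-inj eq))
      (λ i j → proj₁ (heavy _ _ (↑ˡ≢↑ʳ i j)))
      (λ {i} {j} {i′} {j′} eq → combine-injective i j i′ j′ (suc-injective (f-inj eq)))
      (λ i j eq → 0≢suc (f-inj eq))
      (λ i → c∈ _) (λ j → c∈ _) (λ w∈ → disjoint w∈ (f∈Z Fin.zero)) (λ i j z∈ → disjoint z∈ (f∈Z _))
      (λ i j → proj₁ (mid i j)) (λ i j → ~-sym (proj₂ (mid i j)))
      (proj₁ apex) last
    where
    y : Fin (suc (suc s)) → V
    y i = c (i ↑ˡ t)
    x : Fin t → V
    x j = c (suc (suc s) ↑ʳ j)
    0≢suc : ∀ {k} {i : Fin k} → Fin.zero ≢ Fin.suc i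
    0≢suc ()
    ↑ˡ≢↑ʳ : ∀ {k l} (i : Fin k) (j : Fin l) → i ↑ˡ l ≢ k ↑ʳ j
    ↑ˡ≢↑ʳ Fin.zero    j ()
    ↑ˡ≢↑ʳ (Fin.suc i) j eq = ↑ˡ≢↑ʳ i j (suc-injective eq)
    c-inj : ∀ {i j} → c i ≡ c j → i ≡ j
    c-inj {i} {j} eq with i ≟ j
    ... | yes p = p
    ... | no ¬p = contradiction eq (proj₁ (heavy i j ¬p))
    J : ℕ
    J = suc (suc (suc s) * t)
    -- Index zero is the edge r a₀; the remaining indices encode the pairs between the side of size
    -- s + 2 and the side of size t.
    ends : Fin J → V × V
    ends Fin.zero    = y Fin.zero , y (Fin.suc Fin.zero)
    ends (Fin.suc e) = let i , j = Fin.remQuot {suc (suc s)} t e in y i , x j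
    cand : Fin J → List V
    cand e = filter (Common? (proj₁ (ends e)) (proj₂ (ends e))) Z
    heavy-ends : ∀ e → J ≤ codeg Z (proj₁ (ends e)) (proj₂ (ends e))
    heavy-ends Fin.zero    = proj₂ (heavy Fin.zero (Fin.suc Fin.zero) λ ())
    heavy-ends (Fin.suc e) = let i , j = Fin.remQuot {suc (suc s)} t e in
      proj₂ (heavy (i ↑ˡ t) (suc (suc s) ↑ʳ j) (↑ˡ≢↑ʳ i j))
    representatives = distinctRepresentatives J cand [] (λ e → UniqueP.filter⁺ _ uniq)
      (λ e → ≤-trans (≤-reflexive (+-identityʳ J)) (≤-trans (heavy-ends e) (≤-reflexive (sym (length-filter-∑ _ Z)))))
    f = proj₁ representatives
    f-inj : ∀ {i j} → f i ≡ f j → i ≡ j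
    f-inj = proj₁ (proj₂ representatives)
    f∈ : ∀ e → f e ∈ Z × proj₁ (ends e) ~ f e × proj₂ (ends e) ~ f e
    f∈ e = ∈-filter⁻ (Common? (proj₁ (ends e)) (proj₂ (ends e))) {xs = Z} (proj₁ (proj₂ (proj₂ representatives)) e)
    f∈Z : ∀ e → f e ∈ Z
    f∈Z e = proj₁ (f∈ e)
    apex : y Fin.zero ~ f Fin.zero × y (Fin.suc Fin.zero) ~ f Fin.zero
    apex = proj₂ (f∈ Fin.zero)
    mid : ∀ i j → y i ~ f (Fin.suc (combine i j)) × x j ~ f (Fin.suc (combine i j))
    mid i j = subst (λ (i′ , j′) → y i′ ~ f (Fin.suc (combine i j)) × x j′ ~ f (Fin.suc (combine i j)))
                    (remQuot-combine i j) (proj₂ (f∈ (Fin.suc (combine i j))))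
    last : ∀ a → toℕ a ≡ 0 → f Fin.zero ~ y (Fin.suc a)
    last Fin.zero _ = ~-sym (proj₂ apex)

-- Paths of length three without heavy pairs

module Paths {n : ℕ} (G : SimpleGraph n) (L : ℕ) where

  open Graph G public
  open ≤-Reasoning

  -- For `u` adjacent to `c`, this says that u c v is a light cherry: its ends are distinct and not
  -- heavy over `Z`. A good path w y z x is made of the cherries y z x and z y w, which share the
  -- edge y z.
  Ext : List V → V → V → V → Set
  Ext Z c u v = c ~ v × u ≢ v × codeg Z u v < L

  Ext? : ∀ Z c u v → Dec (Ext Z c u v)
  Ext? Z c u v = (c ~? v) ×-dec ¬? (u ≟ v) ×-dec (codeg Z u v <? L)

  ext : List V → List V → V → V → ℕ
  ext X Z c u = ∑ X (λ v → ι (Ext? Z c u v))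

  module _ (X Z : List V) (uniq : Unique X) (j : ℕ) (none : ∀ {Y} → (∀ {v} → v ∈ Y → v ∈ X) → ¬ Clique (Heavy L Z) (suc j) Y) where

    private
      N : V → List V
      N c = filter (c ~?_) X

    -- A neighbour `u` of `c` is poor when it is heavy with all but a fraction `1 / (8 * suc j)` of
    -- `N c`, so that few light cherries start with u c.
    Poor? : ∀ c u → Dec (8 * suc j * non (Heavy? L Z) (N c) u ≤ length (N c))
    Poor? c u = Low? (Heavy? L Z) (8 * suc j) (N c) u

    few-poor : ∀ c → 8 * ∑ X (λ u → ι (c ~? u) * ι (Poor? c u)) ≤ deg X c
    few-poor c = begin
      8 * ∑ X (λ u → ι (c ~? u) * ι (Poor? c u))  ≡⟨ cong (8 *_) (∑-filter (c ~?_) X (λ u → ι (Poor? c u))) ⟨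
      8 * ∑ (N c) (λ u → ι (Poor? c u))           ≤⟨ few-low (Heavy? L Z) j (N c) (none (proj₁ ∘ ∈-filter⁻ (c ~?_))) ⟩
      length (N c)                                ≡⟨ length-filter-∑ (c ~?_) X ⟩
      deg X c                                     ∎

    -- The entries of `N c` not heavy with `u` are light extensions, except possibly `u` itself;
    -- that exception is the reason for `suc κ` in the degree condition.
    ext-big : ∀ {κ} c u → suc κ * (8 * suc j) ≤ deg X c →
              ¬ (8 * suc j * non (Heavy? L Z) (N c) u ≤ length (N c)) → κ ≤ ext X Z c u
    ext-big {κ} c u big rich = ≤-pred (≤-trans (<⇒≤ κ<non) non≤)
      where
      h = 8 * suc j
      κ<non : suc κ < non (Heavy? L Z) (N c) u
      κ<non = *-cancelˡ-< h (suc κ) _ (begin-strict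
        h * suc κ                          ≡⟨ *-comm h (suc κ) ⟩
        suc κ * h                          ≤⟨ big ⟩
        deg X c                            ≡⟨ length-filter-∑ (c ~?_) X ⟨
        length (N c)                       <⟨ ≰⇒> rich ⟩
        h * non (Heavy? L Z) (N c) u       ∎)
      split : ∀ v → ι (c ~? v) * ι (¬? (Heavy? L Z u v)) ≤ ι (v ≟ u) + ι (Ext? Z c u v)
      split v = ≤-trans (≤-reflexive (sym (ι-× (c ~? v) (¬? (Heavy? L Z u v)))))
        (ι-⊎ ((c ~? v) ×-dec ¬? (Heavy? L Z u v)) (v ≟ u) (Ext? Z c u v) cases)
        where
        cases : c ~ v × ¬ Heavy L Z u v → v ≡ u ⊎ Ext Z c u v
        cases (p , ¬h) with v ≟ u
        ... | yes v≡u = inj₁ v≡u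
        ... | no  v≢u = inj₂ (p , v≢u ∘ sym , ≰⇒> (λ l → ¬h (v≢u ∘ sym , l)))
      non≤ : non (Heavy? L Z) (N c) u ≤ suc (ext X Z c u)
      non≤ = begin
        non (Heavy? L Z) (N c) u                              ≡⟨ ∑-filter (c ~?_) X _ ⟩
        ∑ X (λ v → ι (c ~? v) * ι (¬? (Heavy? L Z u v)))      ≤⟨ ∑-mono X (λ {v} _ → split v) ⟩
        ∑ X (λ v → ι (v ≟ u) + ι (Ext? Z c u v))              ≡⟨ ∑-+ X _ _ ⟩
        ∑ X (λ v → ι (v ≟ u)) + ext X Z c u                   ≤⟨ +-monoˡ-≤ _ (∑-≡ uniq u) ⟩
        suc (ext X Z c u)                                     ∎

  module _ (A B : List V) where

    Good : V → V → V → V → Set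
    Good w y z x = y ~ z × Ext B z y x × Ext A y z w

    Good? : ∀ w y z x → Dec (Good w y z x)
    Good? w y z x = (y ~? z) ×-dec (Ext? B z y x ×-dec Ext? A y z w)

    paths : V → ℕ
    paths w = ∑ A (λ y → ∑ B (λ z → ∑ A (λ x → ι (Good? w y z x))))

    -- Once the middle edge y z is fixed, the two ends are chosen independently of each other.
    ∑-paths : ∑ B paths ≡ ∑ A (λ y → ∑ B (λ z → ι (y ~? z) * (ext A B z y * ext B A y z)))
    ∑-paths = begin-equality
      ∑ B (λ w → ∑ A (λ y → ∑ B (λ z → ∑ A (λ x → ι (Good? w y z x)))))
        ≡⟨ ∑-swap B A _ ⟩
      ∑ A (λ y → ∑ B (λ w → ∑ B (λ z → ∑ A (λ x → ι (Good? w y z x)))))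
        ≡⟨ ∑-cong A (λ y → ∑-swap B B _) ⟩
      ∑ A (λ y → ∑ B (λ z → ∑ B (λ w → ∑ A (λ x → ι (Good? w y z x)))))
        ≡⟨ ∑-cong A (λ y → ∑-cong B (λ z → factor y z)) ⟩
      ∑ A (λ y → ∑ B (λ z → ι (y ~? z) * (ext A B z y * ext B A y z))) ∎
      where
      factor : ∀ y z → ∑ B (λ w → ∑ A (λ x → ι (Good? w y z x))) ≡ ι (y ~? z) * (ext A B z y * ext B A y z)
      factor y z = begin-equality
        ∑ B (λ w → ∑ A (λ x → ι (Good? w y z x)))
          ≡⟨ ∑-cong B (λ w → ∑-cong A (λ x → trans (ι-× (y ~? z) (Ext? B z y x ×-dec Ext? A y z w)) (cong (ι (y ~? z) *_) (ι-× (Ext? B z y x) (Ext? A y z w))))) ⟩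
        ∑ B (λ w → ∑ A (λ x → ι (y ~? z) * (ι (Ext? B z y x) * ι (Ext? A y z w))))
          ≡⟨ ∑-cong B (λ w → trans (∑-*ˡ A (ι (y ~? z)) _) (cong (ι (y ~? z) *_) (∑-*ʳ A (ι (Ext? A y z w)) _))) ⟩
        ∑ B (λ w → ι (y ~? z) * (ext A B z y * ι (Ext? A y z w)))
          ≡⟨ trans (∑-*ˡ B (ι (y ~? z)) _) (cong (ι (y ~? z) *_) (∑-*ˡ B (ext A B z y) _)) ⟩
        ι (y ~? z) * (ext A B z y * ext B A y z) ∎

    module _ (uA : Unique A) (uB : Unique B) (j κ : ℕ)
             (noneA : ∀ {Y} → (∀ {v} → v ∈ Y → v ∈ A) → ¬ Clique (Heavy L B) (suc j) Y)
             (noneB : ∀ {Y} → (∀ {v} → v ∈ Y → v ∈ B) → ¬ Clique (Heavy L A) (suc j) Y)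
             (minA : ∀ {y} → y ∈ A → suc κ * (8 * suc j) ≤ deg B y)
             (minB : ∀ {z} → z ∈ B → suc κ * (8 * suc j) ≤ deg A z) where

      private
        PA : V → V → ℕ
        PA z y = ι (Poor? A B uA j noneA z y)
        PB : V → V → ℕ
        PB y z = ι (Poor? B A uB j noneB y z)

        E : ℕ
        E = ∑ B (deg A)

        SA SB : ℕ
        SA = ∑ B (λ z → ∑ A (λ y → ι (z ~? y) * PA z y))
        SB = ∑ A (λ y → ∑ B (λ z → ι (y ~? z) * PB y z))

        E′ : ∑ A (λ y → ∑ B (λ z → ι (y ~? z))) ≡ E
        E′ = trans (∑-swap A B _) (∑-cong B (λ z → ∑-cong A (λ y → ι-~-sym y z)))

        SA≤ : 8 * SA ≤ E
        SA≤ = ≤-trans (≤-reflexive (sym (∑-*ˡ B 8 _))) (∑-mono B (λ {z} _ → few-poor A B uA j noneA z))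

        SB≤ : 8 * SB ≤ E
        SB≤ = ≤-trans (≤-reflexive (sym (∑-*ˡ A 8 _)))
               (≤-trans (∑-mono A (λ {y} _ → few-poor B A uB j noneB y)) (≤-reflexive E′))

        edge : ∀ {y z} → y ∈ A → z ∈ B →
          ι (y ~? z) * (κ * κ) ≤
          ι (z ~? y) * PA z y * (κ * κ) + ι (y ~? z) * PB y z * (κ * κ) + ι (y ~? z) * (ext A B z y * ext B A y z)
        edge {y} {z} y∈ z∈ rewrite ι-~-sym z y = begin
          e * (κ * κ)
            ≤⟨ *-monoʳ-≤ e (ι-unless (Poor? A B uA j noneA z y) (λ ra → ι-unless (Poor? B A uB j noneB y z)
                 (λ rb → *-mono-≤ (ext-big A B uA j noneA {κ} z y (minB z∈) ra) (ext-big B A uB j noneB {κ} y z (minA y∈) rb)))) ⟩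
          e * (PA z y * (κ * κ) + (PB y z * (κ * κ) + ext A B z y * ext B A y z))
            ≡⟨ expand e (PA z y) (PB y z) (κ * κ) (ext A B z y * ext B A y z) ⟩
          e * PA z y * (κ * κ) + e * PB y z * (κ * κ) + e * (ext A B z y * ext B A y z) ∎
          where
          e = ι (y ~? z)
          expand : ∀ e p q k x → e * (p * k + (q * k + x)) ≡ e * p * k + e * q * k + e * x
          expand = solve-∀

        total : E * (κ * κ) ≤ SA * (κ * κ) + SB * (κ * κ) + ∑ B paths
        total = begin
          E * (κ * κ)
            ≡⟨ trans (cong (_* (κ * κ)) (sym E′)) (pull (λ y z → ι (y ~? z))) ⟩
          ∑ A (λ y → ∑ B (λ z → ι (y ~? z) * (κ * κ)))
            ≤⟨ ∑-mono A (λ y∈ → ∑-mono B (λ z∈ → edge y∈ z∈)) ⟩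
          ∑ A (λ y → ∑ B (λ z → f₁ y z * (κ * κ) + f₂ y z * (κ * κ) + f₃ y z))
            ≡⟨ ∑-cong A (λ y → trans (∑-+ B _ (f₃ y)) (cong (_+ ∑ B (f₃ y)) (∑-+ B _ _))) ⟩
          ∑ A (λ y → ∑ B (λ z → f₁ y z * (κ * κ)) + ∑ B (λ z → f₂ y z * (κ * κ)) + ∑ B (f₃ y))
            ≡⟨ trans (∑-+ A _ _) (cong (_+ ∑ A (λ y → ∑ B (f₃ y))) (∑-+ A _ _)) ⟩
          ∑ A (λ y → ∑ B (λ z → f₁ y z * (κ * κ))) + ∑ A (λ y → ∑ B (λ z → f₂ y z * (κ * κ))) + ∑ A (λ y → ∑ B (f₃ y))
            ≡⟨ cong₂ _+_ (cong₂ _+_ (trans (sym (pull f₁)) (cong (_* (κ * κ)) (∑-swap A B f₁))) (sym (pull f₂))) (sym ∑-paths) ⟩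
          SA * (κ * κ) + SB * (κ * κ) + ∑ B paths ∎
          where
          f₁ f₂ f₃ : V → V → ℕ
          f₁ y z = ι (z ~? y) * PA z y
          f₂ y z = ι (y ~? z) * PB y z
          f₃ y z = ι (y ~? z) * (ext A B z y * ext B A y z)
          pull : ∀ f → ∑ A (λ y → ∑ B (f y)) * (κ * κ) ≡ ∑ A (λ y → ∑ B (λ z → f y z * (κ * κ)))
          pull f = trans (sym (∑-*ʳ A (κ * κ) _)) (∑-cong A (λ y → sym (∑-*ʳ B (κ * κ) (f y))))

      -- At most an eighth of the edges is poor at each end, so three quarters are rich at both and
      -- are the middle of at least κ² good paths each. The average is weighted by `deg A w`, whose
      -- sum over `B` is the number of edges; this selects `w` by paths per neighbour.
      many-paths : 0 < length B → ∃ λ w → w ∈ B × κ * κ * deg A w ≤ 2 * paths w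
      many-paths nonempty = ∑-pick B _ _ nonempty (begin
        ∑ B (λ w → κ * κ * deg A w)  ≡⟨ ∑-*ˡ B (κ * κ) _ ⟩
        κ * κ * E                    ≡⟨ *-comm (κ * κ) E ⟩
        E * (κ * κ)                  ≤⟨ arith ⟩
        2 * ∑ B paths                ≡⟨ ∑-*ˡ B 2 paths ⟨
        ∑ B (λ w → 2 * paths w)      ∎)
        where
        k = κ * κ
        P = ∑ B paths
        regroup₁ : ∀ e k → 4 * (e * k) + 2 * (e * k) + 2 * (e * k) ≡ 8 * (e * k)
        regroup₁ = solve-∀
        regroup₂ : ∀ a b k p → 8 * (a * k + b * k + p) ≡ 8 * a * k + 8 * b * k + 8 * p
        regroup₂ = solve-∀
        regroup₃ : ∀ e k p → e * k + e * k + 8 * p ≡ 2 * (e * k) + 4 * (2 * p)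
        regroup₃ = solve-∀
        arith : E * k ≤ 2 * P
        arith = *-cancelˡ-≤ 4 (+-cancelˡ-≤ (2 * (E * k)) _ _ (begin
          2 * (E * k) + 4 * (E * k)                       ≡⟨ +-comm (2 * (E * k)) _ ⟩
          4 * (E * k) + 2 * (E * k)                       ≤⟨ m≤m+n _ (2 * (E * k)) ⟩
          4 * (E * k) + 2 * (E * k) + 2 * (E * k)         ≡⟨ regroup₁ E k ⟩
          8 * (E * k)                                     ≤⟨ *-monoʳ-≤ 8 total ⟩
          8 * (SA * k + SB * k + P)                       ≡⟨ regroup₂ SA SB k P ⟩
          8 * SA * k + 8 * SB * k + 8 * P                 ≤⟨ +-monoˡ-≤ (8 * P) (+-mono-≤ (*-monoˡ-≤ k SA≤) (*-monoˡ-≤ k SB≤)) ⟩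
          E * k + E * k + 8 * P                           ≡⟨ regroup₃ E k P ⟩
          2 * (E * k) + 4 * (2 * P)                       ∎))

-- Sums over tuples of functions of one or two coordinates

module _ {A : Set} where

  open ≤-Reasoning

  ∑-tuples-at : ∀ (S : List A) q (g : A → ℕ) (i : Fin (suc q)) →
                ∑ (tuples S (suc q)) (λ v → g (lookup v i)) ≡ ∑ S g * length S ^ q
  ∑-tuples-at S q g Fin.zero = begin-equality
    ∑ (tuples S (suc q)) (λ v → g (lookup v Fin.zero))  ≡⟨ ∑-tuples S q _ ⟩
    ∑ S (λ y → ∑ (tuples S q) (λ _ → g y))              ≡⟨ ∑-cong S (λ y → trans (∑-const (tuples S q) (g y)) (*-comm _ (g y))) ⟩
    ∑ S (λ y → g y * length (tuples S q))               ≡⟨ ∑-*ʳ S _ g ⟩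
    ∑ S g * length (tuples S q)                         ≡⟨ cong (∑ S g *_) (length-tuples S q) ⟩
    ∑ S g * length S ^ q                                ∎
  ∑-tuples-at S (suc q) g (Fin.suc i) = begin-equality
    ∑ (tuples S (suc (suc q))) (λ v → g (lookup v (Fin.suc i)))  ≡⟨ ∑-tuples S (suc q) _ ⟩
    ∑ S (λ _ → ∑ (tuples S (suc q)) (λ v → g (lookup v i)))      ≡⟨ ∑-const S _ ⟩
    length S * ∑ (tuples S (suc q)) (λ v → g (lookup v i))       ≡⟨ cong (length S *_) (∑-tuples-at S q g i) ⟩
    length S * (∑ S g * length S ^ q)                            ≡⟨ rotate (length S) (∑ S g) (length S ^ q) ⟩
    ∑ S g * length S ^ suc q                                     ∎
    where
    rotate : ∀ a b c → a * (b * c) ≡ b * (a * c)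
    rotate = solve-∀

  module _ (S : List A) (R : A → A → ℕ) (M : ℕ)
           (row : ∀ u → ∑ S (R u) ≤ M) (col : ∀ v → ∑ S (λ u → R u v) ≤ M) where

    private
      rotate : ∀ a b c → a * (b * c) ≡ b * (a * c)
      rotate = solve-∀

      first-coordinate : ∀ q (f : A → Vec A (suc q) → ℕ) → (∀ y → ∑ (tuples S (suc q)) (f y) ≤ M * length S ^ q) →
        ∑ S (λ y → ∑ (tuples S (suc q)) (f y)) ≤ M * length S ^ suc q
      first-coordinate q f bound = begin
        ∑ S (λ y → ∑ (tuples S (suc q)) (f y))  ≤⟨ ∑-mono S (λ {y} _ → bound y) ⟩
        ∑ S (λ _ → M * length S ^ q)            ≡⟨ ∑-const S _ ⟩
        length S * (M * length S ^ q)           ≡⟨ rotate (length S) M (length S ^ q) ⟩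
        M * length S ^ suc q                    ∎

    -- Fixing the earlier of the two coordinates bounds the total weight of the other by `M`.
    -- Whether this is a row or a column of `R` depends on which of `i` and `j` comes first.
    ∑-tuples-at₂ : ∀ q (i j : Fin (suc q)) → i ≢ j →
      ∑ (tuples S (suc q)) (λ v → R (lookup v i) (lookup v j)) ≤ M * length S ^ q
    ∑-tuples-at₂ q       Fin.zero    Fin.zero    i≢j = contradiction refl i≢j
    ∑-tuples-at₂ (suc q) Fin.zero    (Fin.suc j) i≢j = ≤-trans (≤-reflexive (∑-tuples S (suc q) _))
      (first-coordinate q _ (λ y → ≤-trans (≤-reflexive (∑-tuples-at S q (R y) j)) (*-monoˡ-≤ (length S ^ q) (row y))))
    ∑-tuples-at₂ (suc q) (Fin.suc i) Fin.zero    i≢j = ≤-trans (≤-reflexive (∑-tuples S (suc q) _))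
      (first-coordinate q _ (λ y → ≤-trans (≤-reflexive (∑-tuples-at S q (λ u → R u y) i)) (*-monoˡ-≤ (length S ^ q) (col y))))
    ∑-tuples-at₂ (suc q) (Fin.suc i) (Fin.suc j) i≢j = ≤-trans (≤-reflexive (∑-tuples S (suc q) _))
      (first-coordinate q _ (λ _ → ∑-tuples-at₂ q i j (i≢j ∘ cong Fin.suc)))

  ∈-tuples : ∀ (S : List A) q {v : Vec A q} → v ∈ tuples S q → ∀ i → lookup v i ∈ S
  ∈-tuples S (suc q) v∈ i with a , b , a∈ , b∈ , refl ← ∈-cartesianProductWith⁻ _∷_ S (tuples S q) v∈ | i
  ... | Fin.zero  = a∈
  ... | Fin.suc i = ∈-tuples S q b∈ i

  -- A bound may be derived from a single witness. Lightness of a pair is part of the data of a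
  -- path, hence available exactly when the set of paths to be counted is nonempty.
  ∑-if-any : ∀ {P : A → Set} (P? : Decidable P) (xs : List A) {k} →
             (∀ {x} → P x → ∑ xs (λ x → ι (P? x)) ≤ k) → ∑ xs (λ x → ι (P? x)) ≤ k
  ∑-if-any P? xs h with any? P? xs
  ... | yes a = h (proj₂ (proj₂ (find a)))
  ... | no ¬a = ≤-trans (∑-mono xs (λ {x} x∈ → ι-mono (P? x) (no id) (λ p → ¬a (lose x∈ p))))
                        (≤-trans (≤-reflexive (trans (∑-const xs 0) (*-zeroʳ (length xs)))) z≤n)

  ι-all-× : ∀ {P Q : A → Set} (P? : Decidable P) (Q? : Decidable Q) {q} (v : Vec A q) →
            ι (VAll.all? P? v) * ι (VAll.all? Q? v) ≡ ι (VAll.all? (λ y → P? y ×-dec Q? y) v)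
  ι-all-× P? Q? v = trans (sym (ι-× (VAll.all? P? v) (VAll.all? Q? v)))
    (≤-antisym (ι-mono (VAll.all? P? v ×-dec VAll.all? Q? v) (VAll.all? (λ y → P? y ×-dec Q? y) v) VAll.zip)
               (ι-mono (VAll.all? (λ y → P? y ×-dec Q? y) v) (VAll.all? P? v ×-dec VAll.all? Q? v) VAll.unzip))

-- Tuples of links at a fixed vertex

module Apex {n : ℕ} (G : SimpleGraph n) (L : ℕ) (A B : List (Fin n)) (uA : Unique A)
            (w : Fin n) where

  open Paths G L
  open ≤-Reasoning

  Mid : V → V → V → Set
  Mid x y z = Good A B w y z x

  Mid? : ∀ x y z → Dec (Mid x y z)
  Mid? x y z = Good? A B w y z x

  Link : V → V → Set
  Link x y = Any (Mid x y) B

  Link? : ∀ x y → Dec (Link x y)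
  Link? x y = any? (Mid? x y) B

  S : List V
  S = filter (w ~?_) A

  length-S : length S ≡ deg A w
  length-S = length-filter-∑ (w ~?_) A

  d : V → ℕ
  d x = length (filter (Link? x) S)

  d₂ : V → V → ℕ
  d₂ x x′ = length (filter (λ y → Link? x y ×-dec Link? x′ y) S)

  few-mids : ∀ x y → ∑ B (λ z → ι (Mid? x y z)) ≤ L
  few-mids x y = ∑-if-any (Mid? x y) B λ { (_ , (_ , _ , light) , _) →
    ≤-trans (∑-mono B (λ {z} _ → ι-mono (Mid? x y z) (Common? y x z) (λ { (y~z , (z~x , _) , _) → y~z , ~-sym z~x })))
            (<⇒≤ light) }

  -- All such `y` are common neighbours of `z` and `w`, a light pair as soon as one of them exists.
  -- `few-mids` uses the pair {y, x} in the same way.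
  few-ends : ∀ x z → ∑ A (λ y → ι (Mid? x y z)) ≤ L
  few-ends x z = ∑-if-any (λ y → Mid? x y z) A λ { (_ , _ , (_ , _ , light)) →
    ≤-trans (∑-mono A (λ {y} _ → ι-mono (Mid? x y z) (Common? z w y) (λ { (y~z , _ , (y~w , _)) → ~-sym y~z , ~-sym y~w })))
            (<⇒≤ light) }

  mids≤links : ∀ x y → ∑ B (λ z → ι (Mid? x y z)) ≤ L * (ι (w ~? y) * ι (Link? x y))
  mids≤links x y = by-cases (any? (Mid? x y) B)
    where
    by-cases : (l : Dec (Link x y)) → ∑ B (λ z → ι (Mid? x y z)) ≤ L * (ι (w ~? y) * ι (Link? x y))
    by-cases (yes l) = begin
      ∑ B (λ z → ι (Mid? x y z))              ≤⟨ few-mids x y ⟩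
      L                                       ≡⟨ *-identityʳ L ⟨
      L * 1                                   ≡⟨ cong (L *_) (cong₂ _*_ (ι-yes (w ~? y) w~y) (ι-yes (Link? x y) l)) ⟨
      L * (ι (w ~? y) * ι (Link? x y))        ∎
      where
      w~y : w ~ y
      w~y = ~-sym (proj₁ (proj₂ (proj₂ (proj₂ (proj₂ (find l))))))
    by-cases (no ¬l) = ≤-trans (∑-mono B (λ {z} z∈ → ι-mono (Mid? x y z) (no id) (λ m → ¬l (lose z∈ m))))
      (≤-trans (≤-reflexive (trans (∑-const B 0) (*-zeroʳ (length B)))) z≤n)

  paths≤ : paths A B w ≤ L * ∑ A d
  paths≤ = begin
    ∑ A (λ y → ∑ B (λ z → ∑ A (λ x → ι (Mid? x y z))))
      ≡⟨ ∑-cong A (λ y → ∑-swap B A _) ⟩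
    ∑ A (λ y → ∑ A (λ x → ∑ B (λ z → ι (Mid? x y z))))
      ≡⟨ ∑-swap A A _ ⟩
    ∑ A (λ x → ∑ A (λ y → ∑ B (λ z → ι (Mid? x y z))))
      ≤⟨ ∑-mono A (λ {x} _ → ∑-mono A (λ {y} _ → mids≤links x y)) ⟩
    ∑ A (λ x → ∑ A (λ y → L * (ι (w ~? y) * ι (Link? x y))))
      ≡⟨ ∑-cong A (λ x → ∑-*ˡ A L _) ⟩
    ∑ A (λ x → L * ∑ A (λ y → ι (w ~? y) * ι (Link? x y)))
      ≡⟨ ∑-*ˡ A L _ ⟩
    L * ∑ A (λ x → ∑ A (λ y → ι (w ~? y) * ι (Link? x y)))
      ≡⟨ cong (L *_) (∑-cong A (λ x → trans (sym (∑-filter (w ~?_) A _)) (sym (length-filter-∑ (Link? x) S)))) ⟩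
    L * ∑ A d ∎

  module _ {q : ℕ} where

    In? : ∀ (v : Vec V q) x → Dec (All (Link x) v)
    In? v x = VAll.all? (Link? x) v

    X : Vec V q → List V
    X v = filter (In? v) A

    ∑-X : ∑ (tuples S q) (λ v → length (X v)) ≡ ∑ A (λ x → d x ^ q)
    ∑-X = begin-equality
      ∑ (tuples S q) (λ v → length (X v))
        ≡⟨ ∑-cong (tuples S q) (λ v → length-filter-∑ (In? v) A) ⟩
      ∑ (tuples S q) (λ v → ∑ A (λ x → ι (In? v x)))
        ≡⟨ ∑-swap (tuples S q) A _ ⟩
      ∑ A (λ x → ∑ (tuples S q) (λ v → ι (In? v x)))
        ≡⟨ ∑-cong A (λ x → trans (∑-cong (tuples S q) (λ v → sym (*-identityʳ _)))
             (trans (∑-tuples-filter (Link? x) S q (λ _ → 1)) (trans (∑-const (tuples (filter (Link? x) S) q) 1) (trans (*-identityʳ _) (length-tuples _ q))))) ⟩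
      ∑ A (λ x → d x ^ q) ∎

    -- Double counting of the triples (tuple, x, x′) with a weight: the constant weight gives the
    -- second moment `∑-X²`, the indicator of `Bad?` gives the number of collisions.
    ∑-pairs : (f : Vec V q → V → V → ℕ) →
      ∑ (tuples S q) (λ v → ∑ (X v) (λ x → ∑ (X v) (f v x))) ≡
      ∑ A (λ x → ∑ A (λ x′ → ∑ (tuples (filter (λ y → Link? x y ×-dec Link? x′ y) S) q) (λ v → f v x x′)))
    ∑-pairs f = begin-equality
      ∑ (tuples S q) (λ v → ∑ (X v) (λ x → ∑ (X v) (f v x)))
        ≡⟨ ∑-cong (tuples S q) (λ v → trans (∑-filter (In? v) A _) (∑-cong A (λ x →
             trans (cong (ι (In? v x) *_) (∑-filter (In? v) A _)) (sym (∑-*ˡ A (ι (In? v x)) _))))) ⟩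
      ∑ (tuples S q) (λ v → ∑ A (λ x → ∑ A (λ x′ → ι (In? v x) * (ι (In? v x′) * f v x x′))))
        ≡⟨ trans (∑-swap (tuples S q) A _) (∑-cong A (λ x → ∑-swap (tuples S q) A _)) ⟩
      ∑ A (λ x → ∑ A (λ x′ → ∑ (tuples S q) (λ v → ι (In? v x) * (ι (In? v x′) * f v x x′))))
        ≡⟨ ∑-cong A (λ x → ∑-cong A (λ x′ → trans (∑-cong (tuples S q) (λ v →
             trans (sym (*-assoc (ι (In? v x)) _ _)) (cong (_* f v x x′) (ι-all-× (Link? x) (Link? x′) v))))
             (∑-tuples-filter (λ y → Link? x y ×-dec Link? x′ y) S q _))) ⟩
      ∑ A (λ x → ∑ A (λ x′ → ∑ (tuples (filter (λ y → Link? x y ×-dec Link? x′ y) S) q) (λ v → f v x x′))) ∎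

    ∑-X² : ∑ (tuples S q) (λ v → length (X v) * length (X v)) ≡ ∑ A (λ x → ∑ A (λ x′ → d₂ x x′ ^ q))
    ∑-X² = trans
      (∑-cong (tuples S q) (λ v → sym (trans (∑-cong (X v) (λ _ → trans (∑-const (X v) 1) (*-identityʳ _))) (∑-const (X v) (length (X v))))))
      (trans (∑-pairs (λ _ _ _ → 1)) (∑-cong A (λ x → ∑-cong A (λ x′ →
        trans (∑-const (tuples (filter (λ y → Link? x y ×-dec Link? x′ y) S) q) 1) (trans (*-identityʳ _) (length-tuples _ q))))))

  -- Midpoints are chosen only at the very end, so a collision is excluded for every choice of them.
  Meet : V → V → V → V → Set
  Meet x x′ u v = u ≡ v ⊎ Any (λ z → (Mid x u z ⊎ Mid x′ u z) × (Mid x v z ⊎ Mid x′ v z)) B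

  Mid₂? : ∀ x x′ u z → Dec (Mid x u z ⊎ Mid x′ u z)
  Mid₂? x x′ u z = Mid? x u z ⊎-dec Mid? x′ u z

  SharedMid? : ∀ x x′ u v → Dec (Any (λ z → (Mid x u z ⊎ Mid x′ u z) × (Mid x v z ⊎ Mid x′ v z)) B)
  SharedMid? x x′ u v = any? (λ z → Mid₂? x x′ u z ×-dec Mid₂? x x′ v z) B

  Meet? : ∀ x x′ u v → Dec (Meet x x′ u v)
  Meet? x x′ u v = (u ≟ v) ⊎-dec SharedMid? x x′ u v

  -- A collision at a single coordinate: the links of `x` and `x′` to the same `u` could use one
  -- midpoint. `Meet` restricts a pair of coordinates, so this case needs its own bound, which rests
  -- on {x, x′} being light.
  Twin : V → V → V → Set
  Twin x x′ u = Any (λ z → Mid x u z × Mid x′ u z) B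

  Twin? : ∀ x x′ u → Dec (Twin x x′ u)
  Twin? x x′ u = any? (λ z → Mid? x u z ×-dec Mid? x′ u z) B

  Conflict : ∀ {q} → Vec V q → V → V → Set
  Conflict v x x′ = (∃ λ i → Twin x x′ (lookup v i)) ⊎ (∃ λ i → ∃ λ j → i ≢ j × Meet x x′ (lookup v i) (lookup v j))

  Conflict? : ∀ {q} (v : Vec V q) x x′ → Dec (Conflict v x x′)
  Conflict? v x x′ = anyFin? (λ i → Twin? x x′ (lookup v i)) ⊎-dec
                     anyFin? (λ i → anyFin? (λ j → ¬? (i ≟ j) ×-dec Meet? x x′ (lookup v i) (lookup v j)))

  Conflict-sym : ∀ {q} (v : Vec V q) {x x′} → Conflict v x x′ → Conflict v x′ x
  Conflict-sym v (inj₁ (i , twin)) with z , z∈ , m , m′ ← find twin = inj₁ (i , lose z∈ (m′ , m))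
  Conflict-sym v (inj₂ (i , j , i≢j , inj₁ eq)) = inj₂ (i , j , i≢j , inj₁ eq)
  Conflict-sym v (inj₂ (i , j , i≢j , inj₂ shared)) with z , z∈ , m , m′ ← find shared =
    inj₂ (i , j , i≢j , inj₂ (lose z∈ (Sum.swap m , Sum.swap m′)))

  Bad? : ∀ {q} (v : Vec V q) x x′ → Dec (codeg B x x′ < L × Conflict v x x′)
  Bad? v x x′ = (codeg B x x′ <? L) ×-dec Conflict? v x x′

  -- For fixed `u`: one for `v = u`, then at most `L + L` midpoints of links from `u` to `x` or
  -- `x′`, and at most `L + L` choices of `v` through each of them.
  M : ℕ
  M = 1 + (L + L) * (L + L)

  module _ {P Q : V → Set} (P? : Decidable P) (Q? : Decidable Q) where

    private
      S′ : List V
      S′ = filter Q? (filter P? A)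

      ∑S′≤∑A : ∀ f → ∑ S′ f ≤ ∑ A f
      ∑S′≤∑A f = ≤-trans (∑-filter-≤ Q? (filter P? A) f) (∑-filter-≤ P? A f)

      few-mids₂ : ∀ x x′ u → ∑ B (λ z → ι (Mid₂? x x′ u z)) ≤ L + L
      few-mids₂ x x′ u = begin
        ∑ B (λ z → ι (Mid₂? x x′ u z))                                  ≤⟨ ∑-mono B (λ {z} _ → ι-⊎ (Mid₂? x x′ u z) (Mid? x u z) (Mid? x′ u z) id) ⟩
        ∑ B (λ z → ι (Mid? x u z) + ι (Mid? x′ u z))                    ≡⟨ ∑-+ B _ _ ⟩
        ∑ B (λ z → ι (Mid? x u z)) + ∑ B (λ z → ι (Mid? x′ u z))        ≤⟨ +-mono-≤ (few-mids x u) (few-mids x′ u) ⟩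
        L + L                                                           ∎

      few-ends₂ : ∀ x x′ z → ∑ A (λ u → ι (Mid₂? x x′ u z)) ≤ L + L
      few-ends₂ x x′ z = begin
        ∑ A (λ u → ι (Mid₂? x x′ u z))                                  ≤⟨ ∑-mono A (λ {u} _ → ι-⊎ (Mid₂? x x′ u z) (Mid? x u z) (Mid? x′ u z) id) ⟩
        ∑ A (λ u → ι (Mid? x u z) + ι (Mid? x′ u z))                    ≡⟨ ∑-+ A _ _ ⟩
        ∑ A (λ u → ι (Mid? x u z)) + ∑ A (λ u → ι (Mid? x′ u z))        ≤⟨ +-mono-≤ (few-ends x z) (few-ends x′ z) ⟩
        L + L                                                           ∎

    row : ∀ x x′ u → ∑ S′ (λ v → ι (Meet? x x′ u v)) ≤ M
    row x x′ u = begin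
      ∑ S′ (λ v → ι (Meet? x x′ u v))
        ≤⟨ ∑S′≤∑A _ ⟩
      ∑ A (λ v → ι (Meet? x x′ u v))
        ≤⟨ ∑-mono A (λ {v} _ → ≤-trans (ι-⊎ (Meet? x x′ u v) (v ≟ u) (SharedMid? x x′ u v) (λ { (inj₁ e) → inj₁ (sym e) ; (inj₂ m) → inj₂ m }))
             (+-monoʳ-≤ (ι (v ≟ u)) (≤-trans (ι-∃ (λ z → Mid₂? x x′ u z ×-dec Mid₂? x x′ v z) (SharedMid? x x′ u v) B find)
               (≤-reflexive (∑-cong B (λ z → ι-× (Mid₂? x x′ u z) (Mid₂? x x′ v z))))))) ⟩
      ∑ A (λ v → ι (v ≟ u) + ∑ B (λ z → ι (Mid₂? x x′ u z) * ι (Mid₂? x x′ v z)))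
        ≡⟨ ∑-+ A _ _ ⟩
      ∑ A (λ v → ι (v ≟ u)) + ∑ A (λ v → ∑ B (λ z → ι (Mid₂? x x′ u z) * ι (Mid₂? x x′ v z)))
        ≤⟨ +-monoˡ-≤ _ (∑-≡ uA u) ⟩
      1 + ∑ A (λ v → ∑ B (λ z → ι (Mid₂? x x′ u z) * ι (Mid₂? x x′ v z)))
        ≡⟨ cong suc (trans (∑-swap A B _) (∑-cong B (λ z → ∑-*ˡ A (ι (Mid₂? x x′ u z)) _))) ⟩
      1 + ∑ B (λ z → ι (Mid₂? x x′ u z) * ∑ A (λ v → ι (Mid₂? x x′ v z)))
        ≤⟨ s≤s (∑-mono B (λ {z} _ → *-monoʳ-≤ (ι (Mid₂? x x′ u z)) (few-ends₂ x x′ z))) ⟩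
      1 + ∑ B (λ z → ι (Mid₂? x x′ u z) * (L + L))
        ≡⟨ cong suc (∑-*ʳ B (L + L) _) ⟩
      1 + ∑ B (λ z → ι (Mid₂? x x′ u z)) * (L + L)
        ≤⟨ s≤s (*-monoˡ-≤ (L + L) (few-mids₂ x x′ u)) ⟩
      M ∎

    col : ∀ x x′ v → ∑ S′ (λ u → ι (Meet? x x′ u v)) ≤ M
    col x x′ v = ≤-trans (∑-mono S′ (λ {u} _ → ι-mono (Meet? x x′ u v) (Meet? x x′ v u) flip)) (row x x′ v)
      where
      flip : ∀ {u v} → Meet x x′ u v → Meet x x′ v u
      flip (inj₁ e) = inj₁ (sym e)
      flip (inj₂ m) with z , z∈ , a , b ← find m = inj₂ (lose z∈ (b , a))

    -- A shared midpoint is a common neighbour of `x` and `x′`. There are fewer than `L` of these,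
    -- and each is the midpoint for at most `L` vertices `u`.
    twins : ∀ x x′ → codeg B x x′ < L → ∑ S′ (λ u → ι (Twin? x x′ u)) ≤ M
    twins x x′ light = begin
      ∑ S′ (λ u → ι (Twin? x x′ u))
        ≤⟨ ∑S′≤∑A _ ⟩
      ∑ A (λ u → ι (Twin? x x′ u))
        ≤⟨ ∑-mono A (λ {u} _ → ≤-trans (ι-∃ (λ z → Common? x x′ z ×-dec Mid? x u z) (Twin? x x′ u) B (common u))
             (≤-reflexive (∑-cong B (λ z → ι-× (Common? x x′ z) (Mid? x u z))))) ⟩
      ∑ A (λ u → ∑ B (λ z → ι (Common? x x′ z) * ι (Mid? x u z)))
        ≡⟨ trans (∑-swap A B _) (∑-cong B (λ z → ∑-*ˡ A (ι (Common? x x′ z)) _)) ⟩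
      ∑ B (λ z → ι (Common? x x′ z) * ∑ A (λ u → ι (Mid? x u z)))
        ≤⟨ ∑-mono B (λ {z} _ → *-monoʳ-≤ (ι (Common? x x′ z)) (few-ends x z)) ⟩
      ∑ B (λ z → ι (Common? x x′ z) * L)
        ≡⟨ ∑-*ʳ B L _ ⟩
      codeg B x x′ * L
        ≤⟨ *-mono-≤ (≤-trans (<⇒≤ light) (m≤m+n L L)) (m≤m+n L L) ⟩
      (L + L) * (L + L)
        ≤⟨ n≤1+n _ ⟩
      M ∎
      where
      common : ∀ u → Twin x x′ u → ∃ λ z → z ∈ B × (x ~ z × x′ ~ z) × Mid x u z
      common u twin with z , z∈ , m@(_ , (z~x , _) , _) , (_ , (z~x′ , _) , _) ← find twin =
        z , z∈ , (~-sym z~x , ~-sym z~x′) , m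

    -- There are `suc p` possible twins and at most `suc p * suc p` possible meetings, and each
    -- leaves one coordinate at most `M` choices. The exponent drops from `suc p` to `p`, which
    -- makes collisions a lower order term.
    few-bad : ∀ p x x′ → ∑ (tuples S′ (suc p)) (λ v → ι (Bad? v x x′)) ≤ (suc p + suc p * suc p) * (M * length S′ ^ p)
    few-bad p x x′ with codeg B x x′ <? L
    ... | no heavy = ≤-trans (∑-mono T′ (λ {v} _ → ι-mono (Bad? v x x′) (no id) (λ (light , _) → heavy light)))
                       (≤-trans (≤-reflexive (trans (∑-const T′ 0) (*-zeroʳ (length T′)))) z≤n)
      where
      T′ = tuples S′ (suc p)
    ... | yes light = begin
      ∑ T′ (λ v → ι (Bad? v x x′))
        ≤⟨ ∑-mono T′ (λ {v} _ → split v) ⟩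
      ∑ T′ (λ v → ∑ I (λ i → tw v i) + ∑ I (λ i → ∑ I (λ j → me v i j)))
        ≡⟨ trans (∑-+ T′ _ _) (cong₂ _+_ (∑-swap T′ I _) (trans (∑-swap T′ I _) (∑-cong I (λ i → ∑-swap T′ I _)))) ⟩
      ∑ I (λ i → ∑ T′ (λ v → tw v i)) + ∑ I (λ i → ∑ I (λ j → ∑ T′ (λ v → me v i j)))
        ≤⟨ +-mono-≤ (∑-mono I (λ {i} _ → tw≤ i)) (∑-mono I (λ {i} _ → ∑-mono I (λ {j} _ → me≤ i j))) ⟩
      ∑ I (λ i → b) + ∑ I (λ i → ∑ I (λ j → b))
        ≡⟨ cong₂ _+_ (∑-const I b) (trans (∑-const I _) (cong (length I *_) (∑-const I b))) ⟩
      length I * b + length I * (length I * b)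
        ≡⟨ cong (λ l → l * b + l * (l * b)) (length-tabulate {n = suc p} id) ⟩
      suc p * b + suc p * (suc p * b)
        ≡⟨ collect (suc p) b ⟩
      (suc p + suc p * suc p) * b ∎
      where
      collect : ∀ l b → l * b + l * (l * b) ≡ (l + l * l) * b
      collect = solve-∀
      T′ = tuples S′ (suc p)
      I  = allFin (suc p)
      b  = M * length S′ ^ p
      tw : Vec V (suc p) → Fin (suc p) → ℕ
      tw v i = ι (Twin? x x′ (lookup v i))
      me? : ∀ v i j → Dec (i ≢ j × Meet x x′ (lookup v i) (lookup v j))
      me? v i j = ¬? (i ≟ j) ×-dec Meet? x x′ (lookup v i) (lookup v j)
      me : Vec V (suc p) → Fin (suc p) → Fin (suc p) → ℕ
      me v i j = ι (me? v i j)
      tw≤ : ∀ i → ∑ T′ (λ v → tw v i) ≤ b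
      tw≤ i = ≤-trans (≤-reflexive (∑-tuples-at S′ p (λ u → ι (Twin? x x′ u)) i)) (*-monoˡ-≤ (length S′ ^ p) (twins x x′ light))
      me≤ : ∀ i j → ∑ T′ (λ v → me v i j) ≤ b
      me≤ i j with i ≟ j in eq
      ... | yes _ = ≤-trans (≤-reflexive (trans (∑-const T′ 0) (*-zeroʳ (length T′)))) z≤n
      ... | no i≢j = ∑-tuples-at₂ S′ (λ u v → ι (Meet? x x′ u v)) M (row x x′) (col x x′) p i j i≢j
      split : ∀ v → ι (Bad? v x x′) ≤ ∑ I (λ i → tw v i) + ∑ I (λ i → ∑ I (λ j → me v i j))
      split v = ≤-trans
        (ι-⊎ (Bad? v x x′) (anyFin? (λ i → Twin? x x′ (lookup v i))) (anyFin? (λ i → anyFin? (me? v i))) proj₂)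
        (+-mono-≤ (ι-∃ (λ i → Twin? x x′ (lookup v i)) (anyFin? (λ i → Twin? x x′ (lookup v i))) I (λ (i , t) → i , ∈-allFin i , t))
          (≤-trans (ι-∃ (λ i → anyFin? (me? v i)) (anyFin? (λ i → anyFin? (me? v i))) I (λ (i , t) → i , ∈-allFin i , t))
            (∑-mono I (λ {i} _ → ι-∃ (me? v i) (anyFin? (me? v i)) I (λ (j , t) → j , ∈-allFin j , t)))))

-- Cliques without conflicts and the second moment of the tuple counts

young : ∀ a b p → a * b ^ p ≤ a ^ suc p + b ^ suc p
young a b p with ≤-total a b
... | inj₁ a≤b = ≤-trans (*-monoˡ-≤ (b ^ p) a≤b) (m≤n+m _ _)
... | inj₂ b≤a = ≤-trans (*-monoʳ-≤ a (^-monoˡ-≤ p b≤a)) (m≤m+n _ _)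

module Embed {n : ℕ} (G : SimpleGraph n) (L : ℕ) (A B : List (Fin n)) (uA : Unique A) (disjoint : ∀ {v} → v ∈ A → v ∉ B)
             (w : Fin n) (w∈B : w ∈ B) where

  open Paths G L
  open Apex G L A B uA w
  open ≤-Reasoning

  Compatible : ∀ {q} → Vec V q → V → V → Set
  Compatible v x x′ = x ≢ x′ × ¬ Conflict v x x′

  -- Absence of conflicts rules out every collision, so the midpoints returned by `find` will do. A
  -- conflict always refers to a pair of linked vertices; to exclude a repeated entry of `v`, or a
  -- collision of two midpoints at the same vertex, a second linked vertex is brought in, hence at
  -- least two of them.
  compatible⇒contains : ∀ s t {v : Vec V (suc s)} → v ∈ tuples S (suc s) →
    Clique (Compatible v) (suc (suc t)) (X v) → Contains G (subdivision (Kplus s (suc (suc t))))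
  compatible⇒contains s t {v} v∈ clique
    with c , c∈ , compatible ← clique-tuple {R = Compatible v} (λ (x≢ , ¬c) → x≢ ∘ sym , ¬c ∘ Conflict-sym v) clique =
    embedding {Side = _∈ A} (lookup v) c w z
      -- That `y` differs from `x`, and `w` from `z`, is the inequality of ends inside `Ext`.
      y-inj c-inj (λ i j → proj₁ (proj₂ (proj₁ (proj₂ (mid i j)))))
      z-inj (λ i j → proj₁ (proj₂ (proj₂ (proj₂ (mid i j)))) ∘ sym)
      (λ i → proj₁ (y∈ i)) (λ j → proj₁ (c∈′ j)) (λ w∈A → disjoint w∈A w∈B) (λ i j z∈A → disjoint z∈A (z∈B i j))
      (λ i j → proj₁ (mid i j)) (λ i j → proj₁ (proj₁ (proj₂ (mid i j))))
      (~-sym (proj₂ (y∈ Fin.zero))) (λ a _ → proj₂ (y∈ (Fin.suc a)))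
    where
    y∈ : ∀ i → lookup v i ∈ A × w ~ lookup v i
    y∈ i = ∈-filter⁻ (w ~?_) {xs = A} (∈-tuples S (suc s) v∈ i)
    c∈′ : ∀ j → c j ∈ A × All (Link (c j)) v
    c∈′ j = ∈-filter⁻ (In? v) {xs = A} (c∈ j)
    link : ∀ i j → ∃ λ z → z ∈ B × Mid (c j) (lookup v i) z
    link i j = find (VAllP.lookup⁺ (proj₂ (c∈′ j)) i)
    z : Fin (suc s) → Fin (suc (suc t)) → V
    z i j = proj₁ (link i j)
    z∈B : ∀ i j → z i j ∈ B
    z∈B i j = proj₁ (proj₂ (link i j))
    mid : ∀ i j → Mid (c j) (lookup v i) (z i j)
    mid i j = proj₂ (proj₂ (link i j))
    c-inj : ∀ {i j} → c i ≡ c j → i ≡ j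
    c-inj {i} {j} eq with i ≟ j
    ... | yes p = p
    ... | no ¬p = contradiction eq (proj₁ (compatible i j ¬p))
    y-inj : ∀ {i j} → lookup v i ≡ lookup v j → i ≡ j
    y-inj {i} {j} eq with i ≟ j
    ... | yes p = p
    ... | no ¬p = contradiction (inj₂ (i , j , ¬p , inj₁ eq)) (proj₂ (compatible Fin.zero (Fin.suc Fin.zero) λ ()))
    other : (j : Fin (suc (suc t))) → ∃ λ k → j ≢ k
    other Fin.zero    = Fin.suc Fin.zero , λ ()
    other (Fin.suc j) = Fin.zero , λ ()
    z-inj : ∀ {i j i′ j′} → z i j ≡ z i′ j′ → i ≡ i′ × j ≡ j′
    z-inj {i} {j} {i′} {j′} eq with i ≟ i′ | j ≟ j′
    ... | yes p    | yes q    = p , q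
    ... | yes refl | no j≢j′  = contradiction
      (inj₁ (i , lose (z∈B i j) (mid i j , subst (Mid (c j′) (lookup v i)) (sym eq) (mid i j′))))
      (proj₂ (compatible j j′ j≢j′))
    ... | no i≢i′  | no j≢j′  = contradiction
      (inj₂ (i , i′ , i≢i′ , inj₂ (lose (z∈B i j) (inj₁ (mid i j) , inj₂ (subst (Mid (c j′) (lookup v i′)) (sym eq) (mid i′ j′))))))
      (proj₂ (compatible j j′ j≢j′))
    ... | no i≢i′  | yes refl = contradiction
      (inj₂ (i , i′ , i≢i′ , inj₂ (lose (z∈B i j) (inj₁ (mid i j) , inj₁ (subst (Mid (c j) (lookup v i′)) (sym eq) (mid i′ j))))))
      (proj₂ (compatible j (proj₁ (other j)) (proj₂ (other j))))

  module _ (p N c a : ℕ) (c≡ : c ≡ 8 * (8 * suc N)) (a≡ : a ≡ c * ((suc p + suc p * suc p) * M))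
           (none : ∀ {v : Vec V (suc p)} → v ∈ tuples S (suc p) →
                   ¬ Clique (λ x x′ → Heavy L B x x′ ⊎ Compatible v x x′) (suc N) (X v)) where

    private
      q : ℕ
      q = suc p

      R? : ∀ (v : Vec V q) x x′ → Dec (Heavy L B x x′ ⊎ Compatible v x x′)
      R? v x x′ = Heavy? L B x x′ ⊎-dec (¬? (x ≟ x′) ×-dec ¬? (Conflict? v x x′))

      ℓ bad : Vec V q → ℕ
      ℓ v = length (X v)
      bad v = ∑ (X v) (λ x → ∑ (X v) (λ x′ → ι (Bad? v x x′)))

      Ys : List (Vec V q)
      Ys = tuples S q

      non≤ : ∀ (v : Vec V q) → ∑ (X v) (non (R? v) (X v)) ≤ ℓ v + bad v
      non≤ v = begin
        ∑ (X v) (non (R? v) (X v))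
          ≤⟨ ∑-mono (X v) (λ {x} _ → ∑-mono (X v) (λ {x′} _ → ι-⊎ (¬? (R? v x x′)) (x′ ≟ x) (Bad? v x x′) (cases x x′))) ⟩
        ∑ (X v) (λ x → ∑ (X v) (λ x′ → ι (x′ ≟ x) + ι (Bad? v x x′)))
          ≡⟨ trans (∑-cong (X v) (λ x → ∑-+ (X v) _ _)) (∑-+ (X v) _ _) ⟩
        ∑ (X v) (λ x → ∑ (X v) (λ x′ → ι (x′ ≟ x))) + bad v
          ≤⟨ +-monoˡ-≤ (bad v) (∑-mono (X v) (λ {x} _ → ∑-≡ (UniqueP.filter⁺ (In? v) uA) x)) ⟩
        ∑ (X v) (λ _ → 1) + bad v
          ≡⟨ cong (_+ bad v) (trans (∑-const (X v) 1) (*-identityʳ _)) ⟩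
        ℓ v + bad v ∎
        where
        cases : ∀ x x′ → ¬ (Heavy L B x x′ ⊎ Compatible v x x′) → x′ ≡ x ⊎ (codeg B x x′ < L × Conflict v x x′)
        cases x x′ ¬r with x′ ≟ x | Conflict? v x x′
        ... | yes eq | _      = inj₁ eq
        ... | no neq | yes cf = inj₂ (≰⇒> (λ l → ¬r (inj₁ (neq ∘ sym , l))) , cf)
        ... | no neq | no ¬cf = contradiction (inj₂ (neq ∘ sym , ¬cf)) ¬r

      -- By `many-non`, a fixed share of the pairs in `X v` is neither heavy nor compatible, hence
      -- diagonal or bad. The diagonal contributes only `c * ℓ v`, absorbed by `c * c` and one of
      -- the seven squares.
      per-tuple : ∀ {v : Vec V q} → v ∈ Ys → 6 * (ℓ v * ℓ v) ≤ c * c + c * bad v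
      per-tuple {v} v∈ = +-cancelˡ-≤ (ℓ v * ℓ v) _ _ (begin
        ℓ v * ℓ v + 6 * (ℓ v * ℓ v)                      ≡⟨ seven (ℓ v) ⟩
        7 * (ℓ v * ℓ v)                                  ≤⟨ many-non (R? v) N (X v) (none v∈) ⟩
        8 * (8 * suc N * ∑ (X v) (non (R? v) (X v)))     ≡⟨ trans (sym (*-assoc 8 (8 * suc N) _)) (cong (_* ∑ (X v) (non (R? v) (X v))) (sym c≡)) ⟩
        c * ∑ (X v) (non (R? v) (X v))                   ≤⟨ *-monoʳ-≤ c (non≤ v) ⟩
        c * (ℓ v + bad v)                                ≡⟨ *-distribˡ-+ c (ℓ v) (bad v) ⟩
        c * ℓ v + c * bad v                              ≤⟨ +-monoˡ-≤ _ (young₁ c (ℓ v)) ⟩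
        (c * c + ℓ v * ℓ v) + c * bad v                  ≡⟨ rearrange (c * c) (ℓ v * ℓ v) (c * bad v) ⟩
        ℓ v * ℓ v + (c * c + c * bad v)                  ∎)
        where
        seven : ∀ l → l * l + 6 * (l * l) ≡ 7 * (l * l)
        seven = solve-∀
        rearrange : ∀ a b c → a + b + c ≡ b + (a + c)
        rearrange = solve-∀
        young₁ : ∀ a b → a * b ≤ a * a + b * b
        young₁ a b with ≤-total a b
        ... | inj₁ a≤b = ≤-trans (*-monoˡ-≤ b a≤b) (m≤n+m _ _)
        ... | inj₂ b≤a = ≤-trans (*-monoʳ-≤ a b≤a) (m≤m+n _ _)

      H₂ : ℕ
      H₂ = ∑ Ys (λ v → ℓ v * ℓ v)

      -- With `x` and `x′` summed outside, a pair costs at most `a * d₂ x x′ ^ p`. By `young` this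
      -- is covered by `a ^ q` if few links are common, and otherwise by the pair's own share
      -- `d₂ x x′ ^ q` of `H₂`, which the left side of `H₂≤` can spare.
      ∑-bad : c * ∑ Ys bad ≤ length A * (length A * a ^ q) + H₂
      ∑-bad = begin
        c * ∑ Ys bad
          ≡⟨ cong (c *_) (∑-pairs {q} (λ v x x′ → ι (Bad? v x x′))) ⟩
        c * ∑ A (λ x → ∑ A (λ x′ → ∑ (tuples (S₂ x x′) q) (λ v → ι (Bad? v x x′))))
          ≤⟨ *-monoʳ-≤ c (∑-mono A (λ {x} _ → ∑-mono A (λ {x′} _ →
               few-bad (w ~?_) (λ y → Link? x y ×-dec Link? x′ y) p x x′))) ⟩
        c * ∑ A (λ x → ∑ A (λ x′ → (q + q * q) * (M * d₂ x x′ ^ p)))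
          ≡⟨ trans (sym (∑-*ˡ A c _)) (∑-cong A (λ x → trans (sym (∑-*ˡ A c _)) (∑-cong A (λ x′ → trans (assoc c (q + q * q) M (d₂ x x′ ^ p)) (cong (_* d₂ x x′ ^ p) (sym a≡)))))) ⟩
        ∑ A (λ x → ∑ A (λ x′ → a * d₂ x x′ ^ p))
          ≤⟨ ∑-mono A (λ {x} _ → ∑-mono A (λ {x′} _ → young a (d₂ x x′) p)) ⟩
        ∑ A (λ x → ∑ A (λ x′ → a ^ q + d₂ x x′ ^ q))
          ≡⟨ trans (∑-cong A (λ x → ∑-+ A _ _)) (∑-+ A _ _) ⟩
        ∑ A (λ x → ∑ A (λ x′ → a ^ q)) + ∑ A (λ x → ∑ A (λ x′ → d₂ x x′ ^ q))
          ≡⟨ cong₂ _+_ (trans (∑-const A _) (cong (length A *_) (∑-const A (a ^ q)))) (sym (∑-X² {q})) ⟩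
        length A * (length A * a ^ q) + H₂ ∎
        where
        S₂ : V → V → List V
        S₂ x x′ = filter (λ y → Link? x y ×-dec Link? x′ y) S
        assoc : ∀ c k m d → c * (k * (m * d)) ≡ c * (k * m) * d
        assoc = solve-∀

      H₂≤ : 5 * H₂ ≤ c * c * deg A w ^ q + length A * (length A * a ^ q)
      H₂≤ = +-cancelʳ-≤ H₂ _ _ (begin
        5 * H₂ + H₂                                                        ≡⟨ six H₂ ⟩
        6 * H₂                                                             ≡⟨ ∑-*ˡ Ys 6 _ ⟨
        ∑ Ys (λ v → 6 * (ℓ v * ℓ v))                                        ≤⟨ ∑-mono Ys per-tuple ⟩
        ∑ Ys (λ v → c * c + c * bad v)                                      ≡⟨ trans (∑-+ Ys _ _) (cong₂ _+_ (∑-const Ys (c * c)) (∑-*ˡ Ys c bad)) ⟩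
        length Ys * (c * c) + c * ∑ Ys bad                                   ≤⟨ +-monoʳ-≤ (length Ys * (c * c)) ∑-bad ⟩
        length Ys * (c * c) + (length A * (length A * a ^ q) + H₂)          ≡⟨ +-assoc (length Ys * (c * c)) (length A * (length A * a ^ q)) H₂ ⟨
        length Ys * (c * c) + length A * (length A * a ^ q) + H₂            ≡⟨ cong (λ l → l + length A * (length A * a ^ q) + H₂)
                                                                                (trans (*-comm (length Ys) (c * c)) (cong (c * c *_) length-Ys)) ⟩
        c * c * deg A w ^ q + length A * (length A * a ^ q) + H₂           ∎)
        where
        six : ∀ h → 5 * h + h ≡ 6 * h
        six = solve-∀
        length-Ys : length Ys ≡ deg A w ^ q
        length-Ys = trans (length-tuples S q) (cong (_^ q) length-S)

    -- The power mean inequality over `A` bounds `H₁` from below, Cauchy-Schwarz over the tuples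
    -- passes to `H₂`, and `H₂≤` closes the chain.
    link-count-bound : 5 * (∑ A d ^ q * ∑ A d ^ q) ≤
      (length A ^ p * length A ^ p) * (deg A w ^ q * (c * c * deg A w ^ q + length A * (length A * a ^ q)))
    link-count-bound = begin
      5 * (∑ A d ^ q * ∑ A d ^ q)
        ≤⟨ *-monoʳ-≤ 5 (*-mono-≤ (powerMean A d p) (powerMean A d p)) ⟩
      5 * ((length A ^ p * H₁) * (length A ^ p * H₁))
        ≡⟨ regroup₁ (length A ^ p) H₁ ⟩
      (length A ^ p * length A ^ p) * (5 * (H₁ * H₁))
        ≤⟨ *-monoʳ-≤ (length A ^ p * length A ^ p) (*-monoʳ-≤ 5 cauchy) ⟩
      (length A ^ p * length A ^ p) * (5 * (deg A w ^ q * H₂))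
        ≡⟨ cong (length A ^ p * length A ^ p *_) (regroup₂ (deg A w ^ q) H₂) ⟩
      (length A ^ p * length A ^ p) * (deg A w ^ q * (5 * H₂))
        ≤⟨ *-monoʳ-≤ (length A ^ p * length A ^ p) (*-monoʳ-≤ (deg A w ^ q) H₂≤) ⟩
      (length A ^ p * length A ^ p) * (deg A w ^ q * (c * c * deg A w ^ q + length A * (length A * a ^ q))) ∎
      where
      H₁ = ∑ A (λ x → d x ^ q)
      regroup₁ : ∀ l h → 5 * ((l * h) * (l * h)) ≡ (l * l) * (5 * (h * h))
      regroup₁ = solve-∀
      regroup₂ : ∀ e h → 5 * (e * h) ≡ e * (5 * h)
      regroup₂ = solve-∀
      square : ∀ k → k ^ 2 ≡ k * k
      square k = cong (k *_) (*-identityʳ k)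
      cauchy : H₁ * H₁ ≤ deg A w ^ q * H₂
      cauchy = begin
        H₁ * H₁                                       ≡⟨ cong (λ h → h * h) (∑-X {q}) ⟨
        ∑ Ys ℓ * ∑ Ys ℓ                                 ≡⟨ square (∑ Ys ℓ) ⟨
        ∑ Ys ℓ ^ 2                                     ≤⟨ powerMean Ys ℓ 1 ⟩
        length Ys ^ 1 * ∑ Ys (λ v → ℓ v ^ 2)            ≡⟨ cong₂ _*_ (trans (*-identityʳ _) (trans (length-tuples S q) (cong (_^ q) length-S)))
                                                                   (∑-cong Ys (λ v → square (ℓ v))) ⟩
        deg A w ^ q * H₂                              ∎

-- Contradiction from large minimum degree

Clique-⊆ : {A : Set} {R : A → A → Set} {j : ℕ} {X Y : List A} → (∀ {v} → v ∈ X → v ∈ Y) → Clique R j X → Clique R j Y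
Clique-⊆ sub (C , l , C⊆ , r) = C , l , LAll.map sub C⊆ , r

^-distribʳ-* : ∀ k m n → (m * n) ^ k ≡ m ^ k * n ^ k
^-distribʳ-* zero    m n = refl
^-distribʳ-* (suc k) m n = trans (cong (m * n *_) (^-distribʳ-* k m n)) (interchange m n (m ^ k) (n ^ k))
  where
  interchange : ∀ a b c d → a * b * (c * d) ≡ a * c * (b * d)
  interchange = solve-∀

-- The lower bound κ²D / U for `Σd` turns the left side into five copies of one quantity, while the
-- last two hypotheses bound each of the two terms on the right by one copy. They encode κ ≥ const
-- n^(p/(2q)) and κ ≥ const n^(2/5); the second comparison uses `κ ≤ D`.
overcount : ∀ {κ D U Σd ℓ n c₀ c₁} p → let q = suc p in
  0 < κ → κ ≤ D → ℓ ≤ n → κ * κ * D ≤ U * Σd →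
  5 * (Σd ^ q * Σd ^ q) ≤ (ℓ ^ p * ℓ ^ p) * (D ^ q * (c₀ * D ^ q + ℓ * (ℓ * c₁))) →
  (U ^ q * n ^ p) * (U ^ q * n ^ p) * c₀ ≤ (κ * κ) ^ q * (κ * κ) ^ q →
  (U ^ q * n ^ p) * (U ^ q * n ^ p) * (n * (n * c₁)) ≤ (κ * κ) ^ q * (κ * κ) ^ q * κ ^ q → ⊥
overcount {κ} {D} {U} {Σd} {ℓ} {n} {c₀} {c₁} p κ>0 κ≤D ℓ≤n few bound I II =
  <⇒≱ (*-monoˡ-< y {{>-nonZero y>0}} {2} {5} (s≤s (s≤s (s≤s z≤n)))) 5y≤2y
  where
  open ≤-Reasoning
  q = suc p
  K = (κ * κ) ^ q
  E = D ^ q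
  u = U ^ q
  m = n ^ p
  y = E * (K * K * E)
  κ≢0 : NonZero κ
  κ≢0 = >-nonZero κ>0
  K>0 : 0 < K
  K>0 = m^n>0 (κ * κ) {{m*n≢0 κ κ {{κ≢0}} {{κ≢0}}}} q
  E>0 : 0 < E
  E>0 = m^n>0 D {{>-nonZero (≤-trans κ>0 κ≤D)}} q
  y>0 : 0 < y
  y>0 = *-mono-≤ E>0 (*-mono-≤ (*-mono-≤ K>0 K>0) E>0)
  KE≤ : K * E ≤ u * Σd ^ q
  KE≤ = begin
    K * E              ≡⟨ ^-distribʳ-* q (κ * κ) D ⟨
    (κ * κ * D) ^ q    ≤⟨ ^-monoˡ-≤ q few ⟩
    (U * Σd) ^ q       ≡⟨ ^-distribʳ-* q U Σd ⟩
    u * Σd ^ q         ∎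
  r₁ : ∀ k e → 5 * (e * (k * k * e)) ≡ 5 * ((k * e) * (k * e))
  r₁ = solve-∀
  r₂ : ∀ u z → 5 * ((u * z) * (u * z)) ≡ u * u * (5 * (z * z))
  r₂ = solve-∀
  r₃ : ∀ u m e c₀ z → u * u * ((m * m) * (e * (c₀ * e + z))) ≡ e * ((u * m) * (u * m) * c₀ * e + (u * m) * (u * m) * z)
  r₃ = solve-∀
  r₄ : ∀ e k → e * (k * e + k * e) ≡ 2 * (e * (k * e))
  r₄ = solve-∀
  5y≤2y : 5 * y ≤ 2 * y
  5y≤2y = begin
    5 * y                                                             ≡⟨ r₁ K E ⟩
    5 * ((K * E) * (K * E))                                           ≤⟨ *-monoʳ-≤ 5 (*-mono-≤ KE≤ KE≤) ⟩
    5 * ((u * Σd ^ q) * (u * Σd ^ q))                                 ≡⟨ r₂ u (Σd ^ q) ⟩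
    u * u * (5 * (Σd ^ q * Σd ^ q))                                   ≤⟨ *-monoʳ-≤ (u * u) bound ⟩
    u * u * ((ℓ ^ p * ℓ ^ p) * (E * (c₀ * E + ℓ * (ℓ * c₁))))         ≤⟨ *-monoʳ-≤ (u * u) (*-mono-≤ (*-mono-≤ (^-monoˡ-≤ p ℓ≤n) (^-monoˡ-≤ p ℓ≤n))
                                                                          (*-monoʳ-≤ E (+-monoʳ-≤ (c₀ * E) (*-mono-≤ ℓ≤n (*-monoˡ-≤ c₁ ℓ≤n))))) ⟩
    u * u * ((m * m) * (E * (c₀ * E + n * (n * c₁))))                 ≡⟨ r₃ u m E c₀ (n * (n * c₁)) ⟩
    E * ((u * m) * (u * m) * c₀ * E + (u * m) * (u * m) * (n * (n * c₁)))
      ≤⟨ *-monoʳ-≤ E (+-mono-≤ (*-monoˡ-≤ E I) (≤-trans II (*-monoʳ-≤ (K * K) (^-monoˡ-≤ q κ≤D)))) ⟩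
    E * (K * K * E + K * K * E)                                       ≡⟨ r₄ E (K * K) ⟩
    2 * y                                                             ∎

module Core {n : ℕ} (G : SimpleGraph n) (s t L J N c a h : ℕ)
  (L≡ : L ≡ suc (suc (suc s) * suc (suc t))) (J≡ : J ≡ suc s + suc (suc t)) (N≡ : N ≡ 2 ^ (suc J + suc (suc t)))
  (c≡ : c ≡ 8 * (8 * suc N)) (a≡ : a ≡ c * ((suc (suc s) + suc (suc s) * suc (suc s)) * (1 + (L + L) * (L + L))))
  (h≡ : h ≡ 8 * suc J) (free : ¬ Contains G (subdivision (Kplus (suc s) (suc (suc t))))) where

  open Paths G L

  private
    q : ℕ
    q = suc (suc s)

  no-heavyClique : ∀ {X Z} → Unique Z → (∀ {v} → v ∈ X → v ∉ Z) → ¬ Clique (Heavy L Z) (suc J) X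
  no-heavyClique = go L≡ J≡
    where
    go : ∀ {L J} → L ≡ suc (suc (suc s) * suc (suc t)) → J ≡ suc s + suc (suc t) →
         ∀ {X Z} → Unique Z → (∀ {v} → v ∈ X → v ∉ Z) → ¬ Clique (Heavy L Z) (suc J) X
    go refl refl uZ disjoint cl = free (heavyClique⇒contains s (suc (suc t)) uZ disjoint cl)

  module _ (A B : List V) (uA : Unique A) (uB : Unique B) (disjoint : ∀ {v} → v ∈ A → v ∉ B) (κ : ℕ)
           (minA : ∀ {y} → y ∈ A → suc κ * h ≤ deg B y) (minB : ∀ {z} → z ∈ B → suc κ * h ≤ deg A z)
           (κ>0 : 0 < κ) (A≤n : length A ≤ n)
           (I : ((2 * L) ^ q * n ^ suc s) * ((2 * L) ^ q * n ^ suc s) * (c * c) ≤ (κ * κ) ^ q * (κ * κ) ^ q)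
           (II : ((2 * L) ^ q * n ^ suc s) * ((2 * L) ^ q * n ^ suc s) * (n * (n * a ^ q)) ≤
                 (κ * κ) ^ q * (κ * κ) ^ q * κ ^ q) where

    private
      noneA : ∀ {Y} → (∀ {v} → v ∈ Y → v ∈ A) → ¬ Clique (Heavy L B) (suc J) Y
      noneA sub = no-heavyClique uB (disjoint ∘ sub)

      noneB : ∀ {Y} → (∀ {v} → v ∈ Y → v ∈ B) → ¬ Clique (Heavy L A) (suc J) Y
      noneB sub = no-heavyClique uA (λ v∈Y v∈A → disjoint v∈A (sub v∈Y))

      many-paths⇒⊥ : ∀ w → w ∈ B → ¬ (κ * κ * deg A w ≤ 2 * paths A B w)
      many-paths⇒⊥ w w∈B many =
        overcount {κ} {deg A w} {2 * L} {∑ A d} {length A} {n} {c * c} {a ^ q} (suc s) κ>0 (≤-trans κ≤h (minB w∈B)) A≤n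
          (≤-trans many (≤-trans (*-monoʳ-≤ 2 paths≤) (≤-reflexive (sym (*-assoc 2 L (∑ A d))))))
          (link-count-bound (suc s) N c a c≡ a≡ none) I II
        where
        open Apex G L A B uA w
        open Embed G L A B uA disjoint w w∈B
        κ≤h : κ ≤ suc κ * h
        κ≤h = ≤-trans (n≤1+n κ) (m≤m*n (suc κ) h {{subst NonZero (sym h≡) _}})
        -- `N` is the Ramsey bound for a heavy clique on `suc J` vertices, the number of branch
        -- vertices, or a compatible one on as many vertices as the t-part.
        none : ∀ {v : Vec V (suc (suc s))} → v ∈ tuples S (suc (suc s)) →
               ¬ Clique (λ x x′ → Heavy L B x x′ ⊎ Compatible v x x′) (suc N) (X v)
        none {v} v∈ (C , l , C⊆ , r)
          with ramsey {P = Heavy L B} {Q = Compatible v} (Heavy? L B) (suc J) (suc (suc t)) C r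
                 (≤-trans (≤-reflexive (sym N≡)) (≤-trans (n≤1+n N) (≤-reflexive (sym l))))
        ... | inj₁ heavy = noneA (λ u∈ → proj₁ (∈-filter⁻ (In? v) {xs = A} (LAll.lookup C⊆ u∈))) heavy
        ... | inj₂ compatible =
          free (compatible⇒contains (suc s) t v∈ (Clique-⊆ {R = Compatible v} (LAll.lookup C⊆) compatible))

    minDegree⇒⊥ : ¬ (0 < length B)
    minDegree⇒⊥ B>0 =
      let w , w∈B , many = many-paths A B uA uB J κ noneA noneB
                             (λ {y} y∈ → subst (λ h → suc κ * h ≤ deg B y) h≡ (minA y∈))
                             (λ {z} z∈ → subst (λ h → suc κ * h ≤ deg A z) h≡ (minB z∈)) B>0
      in many-paths⇒⊥ w w∈B many

-- Bipartite subgraphs of large minimum degree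

module _ {n : ℕ} (G : SimpleGraph n) where

  open Graph G
  open ≤-Reasoning

  -- `partition` ranges over all `f` in order to split both the size of `U` and the degree of a
  -- vertex into `U`. In `large` the left side counts every edge twice, so at least half of the
  -- edges cross.
  record Cut (U : List V) : Set where
    field
      A B       : List V
      uA        : Unique A
      uB        : Unique B
      disjoint  : ∀ {v} → v ∈ A → v ∉ B
      A⊆U       : ∀ {v} → v ∈ A → v ∈ U
      B⊆U       : ∀ {v} → v ∈ B → v ∈ U
      partition : ∀ (f : V → ℕ) → ∑ U f ≡ ∑ A f + ∑ B f
      large     : ∑ U (deg U) ≤ 4 * ∑ B (deg A)

  ∑-deg-swap : ∀ A B → ∑ A (deg B) ≡ ∑ B (deg A)
  ∑-deg-swap A B = trans (∑-swap A B _) (∑-cong B (λ z → ∑-cong A (λ y → ι-~-sym y z)))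

  ∑-deg-∷ : ∀ u X Y → ∑ Y (deg (u ∷ X)) ≡ deg Y u + ∑ Y (deg X)
  ∑-deg-∷ u X Y = trans (∑-+ Y _ _) (cong (_+ ∑ Y (deg X)) (∑-cong Y (λ v → ι-~-sym v u)))

  -- Each vertex joins the side on which it has at most as many neighbours as on the other, so at
  -- least half of its edges to earlier vertices cross.
  cut : ∀ U → Unique U → Cut U
  cut [] _ = record { A = [] ; B = [] ; uA = [] ; uB = [] ; disjoint = λ () ; A⊆U = λ () ; B⊆U = λ ()
                    ; partition = λ _ → refl ; large = z≤n }
  cut (u ∷ U) (u∉U ∷ uU) with ≤-total (deg (Cut.A (cut U uU)) u) (deg (Cut.B (cut U uU)) u)
  ... | inj₁ le = record
    { A = u ∷ A ; B = B
    ; uA = LAll.tabulate (λ v∈A → LAll.lookup u∉U (A⊆U v∈A)) ∷ uA ; uB = uB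
    ; disjoint = λ { (here refl) v∈B → LAll.lookup u∉U (B⊆U v∈B) refl ; (there v∈A) → disjoint v∈A }
    ; A⊆U = λ { (here eq) → here eq ; (there v∈A) → there (A⊆U v∈A) } ; B⊆U = there ∘ B⊆U
    ; partition = λ f → trans (cong (f u +_) (partition f)) (sym (+-assoc (f u) (∑ A f) (∑ B f)))
    ; large = begin
        ∑ (u ∷ U) (deg (u ∷ U))                     ≡⟨ extended ⟩
        2 * deg U u + ∑ U (deg U)                   ≡⟨ cong (λ k → 2 * k + ∑ U (deg U)) (partition _) ⟩
        2 * (deg A u + deg B u) + ∑ U (deg U)       ≤⟨ +-mono-≤ (*-monoʳ-≤ 2 (+-monoˡ-≤ (deg B u) le)) large ⟩
        2 * (deg B u + deg B u) + 4 * ∑ B (deg A)   ≡⟨ regroup (deg B u) (∑ B (deg A)) ⟩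
        4 * (deg B u + ∑ B (deg A))                 ≡⟨ cong (4 *_) (∑-deg-∷ u A B) ⟨
        4 * ∑ B (deg (u ∷ A))                       ∎ }
    where
    open Cut (cut U uU)
    regroup : ∀ d e → 2 * (d + d) + 4 * e ≡ 4 * (d + e)
    regroup = solve-∀
    regroup′ : ∀ d e → d + (d + e) ≡ 2 * d + e
    regroup′ = solve-∀
    extended : ∑ (u ∷ U) (deg (u ∷ U)) ≡ 2 * deg U u + ∑ U (deg U)
    extended rewrite SimpleGraph.irrefl G u = trans (cong (deg U u +_) (∑-deg-∷ u U U)) (regroup′ (deg U u) (∑ U (deg U)))
  ... | inj₂ le = record
    { A = A ; B = u ∷ B
    ; uA = uA ; uB = LAll.tabulate (λ v∈B → LAll.lookup u∉U (B⊆U v∈B)) ∷ uB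
    ; disjoint = λ { v∈A (here refl) → LAll.lookup u∉U (A⊆U v∈A) refl ; v∈A (there v∈B) → disjoint v∈A v∈B }
    ; A⊆U = there ∘ A⊆U ; B⊆U = λ { (here eq) → here eq ; (there v∈B) → there (B⊆U v∈B) }
    ; partition = λ f → trans (cong (f u +_) (partition f)) (rotate (f u) (∑ A f) (∑ B f))
    ; large = begin
        ∑ (u ∷ U) (deg (u ∷ U))                     ≡⟨ extended ⟩
        2 * deg U u + ∑ U (deg U)                   ≡⟨ cong (λ k → 2 * k + ∑ U (deg U)) (partition _) ⟩
        2 * (deg A u + deg B u) + ∑ U (deg U)       ≤⟨ +-mono-≤ (*-monoʳ-≤ 2 (+-monoʳ-≤ (deg A u) le)) large ⟩
        2 * (deg A u + deg A u) + 4 * ∑ B (deg A)   ≡⟨ regroup (deg A u) (∑ B (deg A)) ⟩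
        4 * (deg A u + ∑ B (deg A))                 ∎ }
    where
    open Cut (cut U uU)
    rotate : ∀ a b c → a + (b + c) ≡ b + (a + c)
    rotate = solve-∀
    regroup : ∀ d e → 2 * (d + d) + 4 * e ≡ 4 * (d + e)
    regroup = solve-∀
    regroup′ : ∀ d e → d + (d + e) ≡ 2 * d + e
    regroup′ = solve-∀
    extended : ∑ (u ∷ U) (deg (u ∷ U)) ≡ 2 * deg U u + ∑ U (deg U)
    extended rewrite SimpleGraph.irrefl G u = trans (cong (deg U u +_) (∑-deg-∷ u U U)) (regroup′ (deg U u) (∑ U (deg U)))

  delete : V → List V → List V
  delete y xs = filter (λ x → ¬? (x ≟ y)) xs

  length-delete : ∀ {y xs} → y ∈ xs → length (delete y xs) < length xs
  length-delete {y} {xs} y∈ = begin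
    1 + length (delete y xs)                                    ≡⟨ cong suc (length-filter-∑ (λ x → ¬? (x ≟ y)) xs) ⟩
    1 + ∑ xs (λ x → ι (¬? (x ≟ y)))                             ≤⟨ +-monoˡ-≤ _ (∑-ι-pos (_≟ y) y∈ refl) ⟩
    ∑ xs (λ x → ι (x ≟ y)) + ∑ xs (λ x → ι (¬? (x ≟ y)))        ≡⟨ ∑-split (_≟ y) xs ⟩
    length xs                                                   ∎

  ∑-delete : ∀ {y xs k} (f : V → ℕ) → Unique xs → f y ≤ k → ∑ xs f ≤ k + ∑ (delete y xs) f
  ∑-delete {y} {xs} {k} f uniq fy≤k = begin
    ∑ xs f
      ≤⟨ ∑-mono xs (λ {x} _ → at x) ⟩
    ∑ xs (λ x → ι (x ≟ y) * k + ι (¬? (x ≟ y)) * f x)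
      ≡⟨ trans (∑-+ xs _ _) (cong₂ _+_ (∑-*ʳ xs k _) (sym (∑-filter (λ x → ¬? (x ≟ y)) xs f))) ⟩
    ∑ xs (λ x → ι (x ≟ y)) * k + ∑ (delete y xs) f
      ≤⟨ +-monoˡ-≤ _ (≤-trans (*-monoˡ-≤ k (∑-≡ uniq y)) (≤-reflexive (*-identityˡ k))) ⟩
    k + ∑ (delete y xs) f ∎
    where
    at : ∀ x → f x ≤ ι (x ≟ y) * k + ι (¬? (x ≟ y)) * f x
    at x with x ≟ y
    ... | yes refl = ≤-trans fy≤k (≤-trans (m≤m+n k 0) (m≤m+n (k + 0) 0))
    ... | no _     = m≤m+n (f x) 0

  record Pruned (k : ℕ) (A B : List V) : Set where
    field
      A′ B′    : List V
      uA       : Unique A′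
      uB       : Unique B′
      disjoint : ∀ {v} → v ∈ A′ → v ∉ B′
      A′≤A     : length A′ ≤ length A
      minA     : ∀ {y} → y ∈ A′ → k ≤ deg B′ y
      minB     : ∀ {z} → z ∈ B′ → k ≤ deg A′ z
      nonempty : 0 < length B′

  -- Deleting a vertex of degree below `k` removes at most `k` edges and lowers
  -- `k * (length A + length B)` by at least `k`, so `dense` survives; being strict, it also keeps
  -- `B` nonempty. The number `m` bounds the remaining deletions.
  prune : ∀ k m A B → length A + length B ≤ m → Unique A → Unique B → (∀ {v} → v ∈ A → v ∉ B) →
          k * (length A + length B) < ∑ B (deg A) → Pruned k A B
  prune k m A B fuel uA uB disjoint dense with any? (λ y → deg B y <? k) A
  prune k zero A B fuel uA uB disjoint dense | yes low =
    contradiction (≤-trans (≤-trans (s≤s z≤n) (length-delete (proj₁ (proj₂ (find low))))) (≤-trans (m≤m+n _ _) fuel)) λ ()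
  prune k (suc m) A B fuel uA uB disjoint dense | yes low =
    record { Pruned P ; A′≤A = ≤-trans (Pruned.A′≤A P) (<⇒≤ (length-delete y∈)) }
    where
    y = proj₁ (find low)
    y∈ = proj₁ (proj₂ (find low))
    A₁ = delete y A
    P : Pruned k A₁ B
    P = prune k m A₁ B (≤-pred (≤-trans (+-monoˡ-≤ (length B) (length-delete y∈)) fuel))
      (UniqueP.filter⁺ (λ x → ¬? (x ≟ y)) uA) uB (disjoint ∘ proj₁ ∘ ∈-filter⁻ (λ x → ¬? (x ≟ y)) {xs = A})
      (+-cancelˡ-< k _ _ (begin-strict
        k + k * (length A₁ + length B)   ≡⟨ *-suc k _ ⟨
        k * (suc (length A₁) + length B) ≤⟨ *-monoʳ-≤ k (+-monoˡ-≤ (length B) (length-delete y∈)) ⟩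
        k * (length A + length B)        <⟨ dense ⟩
        ∑ B (deg A)                      ≡⟨ ∑-deg-swap A B ⟨
        ∑ A (deg B)                      ≤⟨ ∑-delete (deg B) uA (<⇒≤ (proj₂ (proj₂ (find low)))) ⟩
        k + ∑ A₁ (deg B)                 ≡⟨ cong (k +_) (∑-deg-swap A₁ B) ⟩
        k + ∑ B (deg A₁)                 ∎))
  prune k m A B fuel uA uB disjoint dense | no ¬lowA with any? (λ z → deg A z <? k) B
  prune k zero A B fuel uA uB disjoint dense | no ¬lowA | yes low =
    contradiction (≤-trans (≤-trans (s≤s z≤n) (length-delete (proj₁ (proj₂ (find low))))) (≤-trans (m≤n+m _ _) fuel)) λ ()
  prune k (suc m) A B fuel uA uB disjoint dense | no ¬lowA | yes low =
    record { Pruned P }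
    where
    z = proj₁ (find low)
    z∈ = proj₁ (proj₂ (find low))
    B₁ = delete z B
    smaller : suc (length A + length B₁) ≤ length A + length B
    smaller = ≤-trans (≤-reflexive (sym (+-suc (length A) (length B₁)))) (+-monoʳ-≤ (length A) (length-delete z∈))
    P : Pruned k A B₁
    P = prune k m A B₁ (≤-pred (≤-trans smaller fuel))
      uA (UniqueP.filter⁺ (λ x → ¬? (x ≟ z)) uB) (λ v∈A → disjoint v∈A ∘ proj₁ ∘ ∈-filter⁻ (λ x → ¬? (x ≟ z)) {xs = B})
      (+-cancelˡ-< k _ _ (begin-strict
        k + k * (length A + length B₁)   ≡⟨ *-suc k _ ⟨
        k * suc (length A + length B₁)   ≤⟨ *-monoʳ-≤ k smaller ⟩
        k * (length A + length B)        <⟨ dense ⟩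
        ∑ B (deg A)                      ≤⟨ ∑-delete (deg A) uB (<⇒≤ (proj₂ (proj₂ (find low)))) ⟩
        k + ∑ B₁ (deg A)                 ∎))
  prune k m A B fuel uA uB disjoint dense | no ¬lowA | no ¬lowB = record
    { A′ = A ; B′ = B ; uA = uA ; uB = uB ; disjoint = disjoint ; A′≤A = ≤-refl
    ; minA = λ y∈ → ≮⇒≥ (λ lt → ¬lowA (lose y∈ lt)) ; minB = λ z∈ → ≮⇒≥ (λ lt → ¬lowB (lose z∈ lt))
    ; nonempty = positive B dense }
    where
    positive : ∀ B {j} → j < ∑ B (deg A) → 0 < length B
    positive (_ ∷ _) _ = s≤s z≤n

  edgeCount≤∑deg : edgeCount G ≤ ∑ (allFin n) (deg (allFin n))
  edgeCount≤∑deg = begin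
    edgeCount G
      ≡⟨ length-filter-∑ _ (cartesianProduct (allFin n) (allFin n)) ⟩
    ∑ (cartesianProduct (allFin n) (allFin n)) (λ e → ι ((proj₁ e Fin.<? proj₂ e) ×-dec T? (adj G (proj₁ e) (proj₂ e))))
      ≤⟨ ∑-mono (cartesianProduct (allFin n) (allFin n)) (λ {e} _ →
           ι-mono ((proj₁ e Fin.<? proj₂ e) ×-dec T? (adj G (proj₁ e) (proj₂ e))) (proj₁ e ~? proj₂ e) proj₂) ⟩
    ∑ (cartesianProduct (allFin n) (allFin n)) (λ e → ι (proj₁ e ~? proj₂ e))
      ≡⟨ ∑-product _,_ (allFin n) (allFin n) _ ⟩
    ∑ (allFin n) (deg (allFin n)) ∎

  dense⇒pruned : ∀ k → 4 * (k * n) < edgeCount G → ∃ λ A → ∃ λ B → length A ≤ n × Pruned k A B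
  dense⇒pruned k dense = A , B , A≤n , prune k (length A + length B) A B ≤-refl uA uB disjoint (*-cancelˡ-< 4 _ _ (begin-strict
      4 * (k * (length A + length B))   ≡⟨ cong (λ l → 4 * (k * l)) sizes ⟨
      4 * (k * n)                       <⟨ dense ⟩
      edgeCount G                       ≤⟨ edgeCount≤∑deg ⟩
      ∑ (allFin n) (deg (allFin n))     ≤⟨ large ⟩
      4 * ∑ B (deg A)                   ∎))
    where
    open Cut (cut (allFin n) (UniqueP.allFin⁺ n))
    count : ∀ (xs : List V) → ∑ xs (λ _ → 1) ≡ length xs
    count xs = trans (∑-const xs 1) (*-identityʳ _)
    sizes : n ≡ length A + length B
    sizes = trans (sym (trans (count (allFin n)) (length-tabulate {n = n} id)))
                  (trans (partition (λ _ → 1)) (cong₂ _+_ (count A) (count B)))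
    A≤n : length A ≤ n
    A≤n = ≤-trans (m≤m+n _ _) (≤-reflexive (sym sizes))

-- Exponents and constants

^-cancelʳ-≤ : ∀ r .{{_ : NonZero r}} {x y} → x ^ r ≤ y ^ r → x ≤ y
^-cancelʳ-≤ r le = ≮⇒≥ (λ y<x → <⇒≱ (^-monoˡ-< r y<x) le)

-- From C n^e ≤ κ^b one gets c n^m ≤ κ^K after raising to the power j and taking an r-th root.
rescale : ∀ {C n κ b e} c m K r j .{{_ : NonZero r}} .{{_ : NonZero n}} → 0 < C →
  C * n ^ e ≤ κ ^ b → c ^ r ≤ C → m * r ≤ e * suc j → b * suc j ≡ K * r → c * n ^ m ≤ κ ^ K
rescale {C} {n} {κ} {b} {e} c m K r j C>0 hyp c≤C m≤ K≡ = ^-cancelʳ-≤ r (begin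
  (c * n ^ m) ^ r              ≡⟨ trans (^-distribʳ-* r c (n ^ m)) (cong (c ^ r *_) (^-*-assoc n m r)) ⟩
  c ^ r * n ^ (m * r)          ≤⟨ *-mono-≤ (≤-trans c≤C C≤C^) (^-monoʳ-≤ n m≤) ⟩
  C ^ suc j * n ^ (e * suc j)  ≡⟨ trans (^-distribʳ-* (suc j) C (n ^ e)) (cong (C ^ suc j *_) (^-*-assoc n e (suc j))) ⟨
  (C * n ^ e) ^ suc j          ≤⟨ ^-monoˡ-≤ (suc j) hyp ⟩
  (κ ^ b) ^ suc j              ≡⟨ trans (^-*-assoc κ b (suc j)) (trans (cong (κ ^_) K≡) (sym (^-*-assoc κ K r))) ⟩
  (κ ^ K) ^ r                  ∎)
  where
  open ≤-Reasoning
  C≤C^ : C ≤ C ^ suc j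
  C≤C^ = m≤m*n C (C ^ j) {{m^n≢0 C j {{>-nonZero C>0}}}}

-- This is (s - 2)² + 1 ≥ 0. It places the threshold exponent 2/5 below (s² + 1) / (2s + 2s²).
4s≤s²+5 : ∀ s → 4 * s ≤ s * s + 5
4s≤s²+5 0 = z≤n
4s≤s²+5 1 = m≤m+n 4 2
4s≤s²+5 2 = m≤m+n 8 1
4s≤s²+5 3 = m≤m+n 12 2
4s≤s²+5 s@(suc (suc (suc (suc _)))) = ≤-trans (*-monoˡ-≤ s {4} {s} (s≤s (s≤s (s≤s (s≤s z≤n))))) (m≤m+n (s * s) 5)

-- The exponent 3s² + 2s + 1 is b + (s² + 1) with b = 2s(s + 1).
module _ (s : ℕ) .{{_ : NonZero s}} (h : ℕ) .{{_ : NonZero h}} (U c₀ c₁ : ℕ) where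

  open ≤-Reasoning

  private
    q b C′ : ℕ
    q  = suc s
    b  = 2 * s + 2 * (s * s)
    -- One summand for each use of `rescale`, with roots of order `s` and `2 * s`; the successor
    -- makes `C′` positive.
    C′ = suc ((U ^ q * U ^ q * c₀) ^ s + (U ^ q * U ^ q * c₁) ^ (2 * s))

  constant : ℕ
  constant = (32 * h) ^ b * C′

  private
    exponent : 3 * (s * s) + 2 * s + 1 ≡ b + (s * s + 1)
    exponent = ring s
      where
      ring : ∀ s → 3 * (s * s) + 2 * s + 1 ≡ 2 * s + 2 * (s * s) + (s * s + 1)
      ring = solve-∀

    square-^ : ∀ κ k → (κ * κ) ^ k * (κ * κ) ^ k ≡ κ ^ (4 * k)
    square-^ κ k = trans (sym (^-distribˡ-+-* (κ * κ) k k))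
      (trans (cong (_^ (k + k)) (cong (κ *_) (sym (*-identityʳ κ)))) (trans (^-*-assoc κ 2 (k + k)) (cong (κ ^_) (ring k))))
      where
      ring : ∀ k → 2 * (k + k) ≡ 4 * k
      ring = solve-∀

    -- Square the hypothesis and take an `s`-th root: `b * 2` equals `4 * q * s`, and the exponent
    -- of `n` has 2 to spare before the root.
    first-condition : ∀ n κ .{{_ : NonZero n}} → C′ * n ^ (s * s + 1) ≤ κ ^ b →
      (U ^ q * n ^ s) * (U ^ q * n ^ s) * c₀ ≤ (κ * κ) ^ q * (κ * κ) ^ q
    first-condition n κ hyp = begin
      (U ^ q * n ^ s) * (U ^ q * n ^ s) * c₀  ≡⟨ regroup (U ^ q) (n ^ s) c₀ ⟩
      U ^ q * U ^ q * c₀ * (n ^ s * n ^ s)    ≡⟨ cong (U ^ q * U ^ q * c₀ *_) (^-distribˡ-+-* n s s) ⟨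
      U ^ q * U ^ q * c₀ * n ^ (s + s)        ≤⟨ rescale {C′} {n} {κ} {b} {s * s + 1} (U ^ q * U ^ q * c₀) (s + s) (4 * q) s 1 (s≤s z≤n) hyp
                                                   (≤-trans (m≤m+n _ _) (n≤1+n _)) exponents (ring s) ⟩
      κ ^ (4 * q)                             ≡⟨ square-^ κ q ⟨
      (κ * κ) ^ q * (κ * κ) ^ q               ∎
      where
      regroup : ∀ u m c → (u * m) * (u * m) * c ≡ u * u * c * (m * m)
      regroup = solve-∀
      ring : ∀ s → (2 * s + 2 * (s * s)) * 2 ≡ 4 * suc s * s
      ring = solve-∀
      ring′ : ∀ s → (s + s) * s + 2 ≡ (s * s + 1) * 2
      ring′ = solve-∀
      exponents : (s + s) * s ≤ (s * s + 1) * 2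
      exponents = ≤-trans (m≤m+n _ 2) (≤-reflexive (ring′ s))

    -- Take the fifth power of the hypothesis and a root of order `2 * s`: `b * 5` equals
    -- `5 * q * (2 * s)`, and the exponents of `n` compare by `4s≤s²+5`.
    second-condition : ∀ n κ .{{_ : NonZero n}} → C′ * n ^ (s * s + 1) ≤ κ ^ b →
      (U ^ q * n ^ s) * (U ^ q * n ^ s) * (n * (n * c₁)) ≤ (κ * κ) ^ q * (κ * κ) ^ q * κ ^ q
    second-condition n κ hyp = begin
      (U ^ q * n ^ s) * (U ^ q * n ^ s) * (n * (n * c₁))  ≡⟨ regroup (U ^ q) (n ^ s) n c₁ ⟩
      U ^ q * U ^ q * c₁ * (n ^ suc s * n ^ suc s)        ≡⟨ cong (U ^ q * U ^ q * c₁ *_) (^-distribˡ-+-* n (suc s) (suc s)) ⟨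
      U ^ q * U ^ q * c₁ * n ^ (q + q)                    ≤⟨ rescale {C′} {n} {κ} {b} {s * s + 1} (U ^ q * U ^ q * c₁) (q + q) (5 * q) (2 * s) 4
                                                               {{m*n≢0 2 s}} (s≤s z≤n) hyp
                                                               (≤-trans (m≤n+m _ _) (n≤1+n _)) exponents (ring s) ⟩
      κ ^ (5 * q)                                         ≡⟨ trans (cong (κ ^_) (ring″ q)) (^-distribˡ-+-* κ (4 * q) q) ⟩
      κ ^ (4 * q) * κ ^ q                                 ≡⟨ cong (_* κ ^ q) (square-^ κ q) ⟨
      (κ * κ) ^ q * (κ * κ) ^ q * κ ^ q                   ∎
      where
      regroup : ∀ u m n c → (u * m) * (u * m) * (n * (n * c)) ≡ u * u * c * ((n * m) * (n * m))
      regroup = solve-∀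
      ring : ∀ s → (2 * s + 2 * (s * s)) * 5 ≡ 5 * suc s * (2 * s)
      ring = solve-∀
      ring′ : ∀ s → (suc s + suc s) * (2 * s) ≡ 4 * (s * s) + 4 * s
      ring′ = solve-∀
      ring‴ : ∀ s → 4 * (s * s) + (s * s + 5) ≡ (s * s + 1) * 5
      ring‴ = solve-∀
      ring″ : ∀ q → 5 * q ≡ 4 * q + q
      ring″ = solve-∀
      exponents : (q + q) * (2 * s) ≤ (s * s + 1) * 5
      exponents = begin
        (q + q) * (2 * s)          ≡⟨ ring′ s ⟩
        4 * (s * s) + 4 * s        ≤⟨ +-monoʳ-≤ (4 * (s * s)) (4s≤s²+5 s) ⟩
        4 * (s * s) + (s * s + 5)  ≡⟨ ring‴ s ⟩
        (s * s + 1) * 5            ∎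

  -- The test value is κ = `e / (16 * (h * n))`. For κ ≥ 1 the factor 16 leaves room for
  -- `4 * (suc κ * h * n) < e`, and rounding down loses at most a factor 2, so `e ≤ 32 * h * n * κ`;
  -- this is the 32 in `constant`.
  edge-bound : ∀ n e .{{_ : NonZero n}} →
    (∀ κ → 0 < κ → 4 * (suc κ * h * n) < e →
      (U ^ q * n ^ s) * (U ^ q * n ^ s) * c₀ ≤ (κ * κ) ^ q * (κ * κ) ^ q →
      (U ^ q * n ^ s) * (U ^ q * n ^ s) * (n * (n * c₁)) ≤ (κ * κ) ^ q * (κ * κ) ^ q * κ ^ q → ⊥) →
    e ^ b ≤ constant * n ^ (3 * (s * s) + 2 * s + 1)
  edge-bound n e impossible = ≮⇒≥ λ big → absurd big (e / D) refl
    where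
    instance
      D≢0 : NonZero (16 * (h * n))
      D≢0 = m*n≢0 16 (h * n) {{_}} {{m*n≢0 h n}}
    D : ℕ
    D = 16 * (h * n)
    a : ℕ
    a = 3 * (s * s) + 2 * s + 1
    target : constant * n ^ a ≡ (32 * h) ^ b * n ^ b * (C′ * n ^ (s * s + 1))
    target = trans (cong (λ k → constant * n ^ k) exponent) (trans (cong (constant *_) (^-distribˡ-+-* n b (s * s + 1)))
      (regroup ((32 * h) ^ b) C′ (n ^ b) (n ^ (s * s + 1))))
      where
      regroup : ∀ x c m k → x * c * (m * k) ≡ x * m * (c * k)
      regroup = solve-∀
    big⇒κ : ∀ k → constant * n ^ a < e ^ b → e ≤ 32 * h * n * k → C′ * n ^ (s * s + 1) < k ^ b
    big⇒κ k big e≤ = *-cancelˡ-< ((32 * h) ^ b * n ^ b) _ _ (begin-strict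
      (32 * h) ^ b * n ^ b * (C′ * n ^ (s * s + 1))  ≡⟨ target ⟨
      constant * n ^ a                               <⟨ big ⟩
      e ^ b                                          ≤⟨ ^-monoˡ-≤ b e≤ ⟩
      (32 * h * n * k) ^ b                           ≡⟨ trans (^-distribʳ-* b (32 * h * n) k) (cong (_* k ^ b) (^-distribʳ-* b (32 * h) n)) ⟩
      (32 * h) ^ b * n ^ b * k ^ b                   ∎)
    e< : e < D + e / D * D
    e< = ≤-trans (s≤s (≤-reflexive (m≡m%n+[m/n]*n e D))) (+-monoˡ-≤ _ (m%n<n e D))
    absurd : constant * n ^ a < e ^ b → ∀ κ → e / D ≡ κ → ⊥
    -- Here `e ≤ D`, so `big⇒κ` at `k = 1` would make the positive number `C′ * n ^ (s * s + 1)`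
    -- smaller than 1.
    absurd big zero κ≡ = <⇒≱ (big⇒κ 1 big e≤) (≤-trans (≤-reflexive (^-zeroˡ b)) (*-mono-≤ {1} {C′} (s≤s z≤n) (m^n>0 n (s * s + 1))))
      where
      regroup : ∀ h n → 16 * (h * n) + 16 * (h * n) ≡ 32 * h * n * 1
      regroup = solve-∀
      e≤ : e ≤ 32 * h * n * 1
      e≤ = begin
        e                  ≤⟨ <⇒≤ (m/n≡0⇒m<n κ≡) ⟩
        D                  ≤⟨ m≤m+n D D ⟩
        D + D              ≡⟨ regroup h n ⟩
        32 * h * n * 1     ∎
    absurd big κ@(suc κ-1) κ≡ = impossible κ (s≤s z≤n) dense
        (first-condition n κ (<⇒≤ (big⇒κ κ big e≤))) (second-condition n κ (<⇒≤ (big⇒κ κ big e≤)))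
      where
      regroup : ∀ h n κ → 16 * (h * n) + 16 * (h * n) + (κ * (16 * (h * n)) + κ * (16 * (h * n))) ≡ 32 * h * n * suc κ
      regroup = solve-∀
      e≤ : e ≤ 32 * h * n * κ
      e≤ = begin
        e                                        ≤⟨ <⇒≤ e< ⟩
        D + e / D * D                            ≡⟨ cong (λ k → D + k * D) κ≡ ⟩
        D + (D + κ-1 * D)                        ≡⟨ +-assoc D D (κ-1 * D) ⟨
        D + D + κ-1 * D                          ≤⟨ +-monoʳ-≤ (D + D) (m≤m+n _ _) ⟩
        D + D + (κ-1 * D + κ-1 * D)              ≡⟨ regroup h n κ-1 ⟩
        32 * h * n * κ                           ∎
      regroup′ : ∀ h n k → 4 * (suc (suc k) * h * n) + (4 * (h * n) + 4 * (h * n) + (4 * (k * (h * n)) + 8 * (k * (h * n)))) ≡ suc k * (16 * (h * n))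
      regroup′ = solve-∀
      dense : 4 * (suc κ * h * n) < e
      dense = begin-strict
        4 * (suc κ * h * n)                     <⟨ m<m+n _ (≤-trans hn>0 (≤-trans (m≤m+n (4 * (h * n)) _) (m≤m+n _ _))) ⟩
        4 * (suc κ * h * n) + (4 * (h * n) + 4 * (h * n) + (4 * (κ-1 * (h * n)) + 8 * (κ-1 * (h * n))))
                                                ≡⟨ regroup′ h n κ-1 ⟩
        κ * D                                   ≡⟨ cong (_* D) κ≡ ⟨
        e / D * D                               ≤⟨ m/n*n≤m e D ⟩
        e                                       ∎
        where
        hn>0 : 0 < 4 * (h * n)
        hn>0 = *-mono-≤ {1} {4} (s≤s z≤n) (>-nonZero⁻¹ (h * n) {{m*n≢0 h n}})

-- The constants are variables with defining equations because their closed forms are too expensive to normalise.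
edgeCount-bound : ∀ s t L J N c a h →
  L ≡ suc (suc (suc s) * suc (suc t)) → J ≡ suc s + suc (suc t) → N ≡ 2 ^ (suc J + suc (suc t)) →
  c ≡ 8 * (8 * suc N) → a ≡ c * ((suc (suc s) + suc (suc s) * suc (suc s)) * (1 + (L + L) * (L + L))) →
  h ≡ 8 * suc J →
  ∃ λ C → ∀ n → .{{_ : NonZero n}} → (G : SimpleGraph n) → ¬ Contains G (subdivision (Kplus (suc s) (suc (suc t)))) →
  edgeCount G ^ (2 * suc s + 2 * (suc s * suc s)) ≤ C * n ^ (3 * (suc s * suc s) + 2 * suc s + 1)
edgeCount-bound s t L J N c a h L≡ J≡ N≡ c≡ a≡ h≡ =
  constant (suc s) h (2 * L) (c * c) (a ^ suc (suc s)) , λ n G free →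
  edge-bound (suc s) h (2 * L) (c * c) (a ^ suc (suc s)) n (edgeCount G) λ κ κ>0 dense I II →
    let A , B , A≤n , P = dense⇒pruned G (suc κ * h) dense
        open Pruned P
    in Core.minDegree⇒⊥ G s t L J N c a h L≡ J≡ N≡ c≡ a≡ h≡ free
         A′ B′ uA uB disjoint κ minA minB κ>0 (≤-trans A′≤A A≤n) I II nonempty
  where
  instance
    h≢0 : NonZero h
    h≢0 = subst NonZero (sym h≡) _

theorem1p7 : (s t : ℕ) → 3 ≤ s → s + 1 ≤ t →
    Σ ℕ λ C → (n : ℕ) → (G : SimpleGraph n) →
    ¬ Contains G (subdivision (Kplus s t)) →
    edgeCount G ^ (2 * s + 2 * (s * s)) ≤ C * n ^ (3 * (s * s) + 2 * s + 1)
theorem1p7 (suc s) (suc (suc t)) _ _ =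
  let C , bound = edgeCount-bound s t _ _ _ _ _ _ refl refl refl refl refl refl
  -- For `n = 0` there are no edges and the left side is a positive power of zero.
  in C , λ { zero _ _ → z≤n ; n@(suc _) G free → bound n G free }
theorem1p7 (suc _) zero       _             ()
theorem1p7 (suc _) (suc zero) (s≤s (s≤s _)) (s≤s ())
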